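{- Let $G_1=([n],E_1)$ and $G_2=([n],E_2)$ be simple undirected graphs on $n$ vertices each, and let $cp\vartheta$ denote the optimal value of the completely positive program CP-LT associated with $(G_1,G_2)$. If $G_1$ and $G_2$ are isomorphic, then $cp\vartheta = n$. If $G_1$ and $G_2$ are not isomorphic, then $cp\vartheta < n-\frac{1}{4n^4}$. In particular, this gives a test for graph isomorphism: $G_1$ and $G_2$ are isomorphic if and only if $cp\vartheta=n$.
   Context: $[n]=\{1,\dots,n\}$. Edges are unordered pairs of distinct vertices; $(i,k)\in E$ means that $\{i,k\}$ is an edge (so $(i,i)\notin E$). $G_1$ and $G_2$ are isomorphic if there is a bijection $\sigma:[n]\to[n]$ with $(\sigma(x),\sigma(y))\in E_2$ if and only if $(x,y)\in E_1$. A real symmetric $m\times m$ matrix $M$ is completely positive (CP) if $M=QQ^T$ for some real $m\times k$ matrix $Q$ with all entries non-negative. The program CP-LT for $(G_1,G_2)$: the variable is a real symmetric $(n^2+1)\times(n^2+1)$ matrix $Y$ with rows and columns indexed by $\{ij \mid i,j\in[n]\}\cup\{\omega\}$. Maximize $\sum_{i,j\in[n]}Y_{ij,ij}$ subject to: $Y$ is completely positive; $Y_{\omega,\omega}=1$; $Y_{ij,\omega}=Y_{ij,ij}$ for all $i,j\in[n]$; $Y_{ij,ik}=0$ for all $i,j,k\in[n]$ with $j\neq k$; $Y_{ji,ki}=0$ for all $i,j,k\in[n]$ with $j\ne k$; $Y_{ij,kl}=0$ whenever $(i,k)\in E_1$ and $(j,l)\notin E_2$; $Y_{ij,kl}=0$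 whenever $(i,k)\notin E_1$ and $(j,l)\in E_2$. -}

module Defs where

open import Algebra.Bundles using (CommutativeMonoid)
open import Algebra.Bundles.Raw using (RawRing)
import Algebra.Properties.CommutativeSemigroup as CommutativeSemigroupProperties
open import Data.Fin using (Fin)
open import Data.Fin.Permutation using (Permutation′; _⟨$⟩ʳ_)
open import Data.Integer using (+_)
open import Data.Nat as ℕ using (ℕ; NonZero)
import Data.Nat.Properties as ℕ
open import Data.Product using (∃; _×_; _,_)
open import Data.Rational as ℚ using (ℚ; 0ℚ; 1ℚ; ½; ∣_∣)
import Data.Rational.Properties as ℚ
open import Function.Bundles using (_⇔_)
open import Level using (0ℓ)
open import Relation.Binary.Core using (Rel)
open import Relation.Binary.Definitions using (Symmetric; Irreflexive; Decidable)
open import Relation.Binary.PropositionalEquality using (_≡_; _≢_; refl; sym; trans; cong; cong₂; subst; module ≡-Reasoning)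
open import Relation.Nullary using (¬_)

-- A real is represented by a Cauchy sequence of rationals; equality of reals
-- is _≃_ (the difference tends to 0), not _≡_.
IsCauchy : (ℕ → ℚ) → Set
IsCauchy x = ∀ ε → 0ℚ ℚ.< ε → ∃ λ N → ∀ m n → N ℕ.≤ m → N ℕ.≤ n → ∣ x m ℚ.- x n ∣ ℚ.< ε

record ℝ : Set where
  constructor mkℝ
  field
    seq    : ℕ → ℚ
    cauchy : IsCauchy seq

open ℝ public

infix 4 _≃_ _<_ _≤_

_≃_ : Rel ℝ 0ℓ
x ≃ y = ∀ ε → 0ℚ ℚ.< ε → ∃ λ N → ∀ n → N ℕ.≤ n → ∣ seq x n ℚ.- seq y n ∣ ℚ.< ε

-- A termwise strict inequality would not be enough: the sequences must
-- stay apart by a fixed positive rational.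
_<_ : Rel ℝ 0ℓ
x < y = ∃ λ ε → 0ℚ ℚ.< ε × ∃ λ N → ∀ n → N ℕ.≤ n → seq x n ℚ.+ ε ℚ.≤ seq y n

_≤_ : Rel ℝ 0ℓ
x ≤ y = ∀ ε → 0ℚ ℚ.< ε → ∃ λ N → ∀ n → N ℕ.≤ n → seq x n ℚ.≤ seq y n ℚ.+ ε

fromℚ : ℚ → ℝ
fromℚ q = mkℝ (λ _ → q) λ ε 0<ε →
  0 , λ _ _ _ _ → subst (ℚ._< ε) (sym (cong ∣_∣ (ℚ.+-inverseʳ q))) 0<ε

fromℕ : ℕ → ℝ
fromℕ n = fromℚ (+ n ℚ./ 1)

0ℝ 1ℝ : ℝ
0ℝ = fromℚ 0ℚ
1ℝ = fromℚ 1ℚ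

private
  open CommutativeSemigroupProperties (CommutativeMonoid.commutativeSemigroup ℚ.+-0-commutativeMonoid) using (interchange)

  abstract
    half-pos : ∀ {ε} → 0ℚ ℚ.< ε → 0ℚ ℚ.< ½ ℚ.* ε
    half-pos {ε} 0<ε = subst (ℚ._< ½ ℚ.* ε) (ℚ.*-zeroʳ ½) (ℚ.*-monoʳ-<-pos ½ 0<ε)

    halves : ∀ ε → ½ ℚ.* ε ℚ.+ ½ ℚ.* ε ≡ ε
    halves ε = trans (sym (ℚ.*-distribʳ-+ ε ½ ½)) (ℚ.*-identityˡ ε)

    p-q+q≡p : ∀ p q → (p ℚ.- q) ℚ.+ q ≡ p
    p-q+q≡p p q = trans (ℚ.+-assoc p (ℚ.- q) q)
      (trans (cong (p ℚ.+_) (ℚ.+-inverseˡ q)) (ℚ.+-identityʳ p))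

    product-difference : ∀ a b c d →
      a ℚ.* b ℚ.- c ℚ.* d ≡ a ℚ.* (b ℚ.- d) ℚ.+ (a ℚ.- c) ℚ.* d
    product-difference a b c d = begin
      a ℚ.* b ℚ.- c ℚ.* d
        ≡⟨ cong₂ (λ u v → a ℚ.* u ℚ.+ v) (sym (p-q+q≡p b d)) (ℚ.neg-distribˡ-* c d) ⟩
      a ℚ.* ((b ℚ.- d) ℚ.+ d) ℚ.+ (ℚ.- c) ℚ.* d
        ≡⟨ cong (ℚ._+ (ℚ.- c) ℚ.* d) (ℚ.*-distribˡ-+ a (b ℚ.- d) d) ⟩
      a ℚ.* (b ℚ.- d) ℚ.+ a ℚ.* d ℚ.+ (ℚ.- c) ℚ.* d
        ≡⟨ ℚ.+-assoc (a ℚ.* (b ℚ.- d)) (a ℚ.* d) ((ℚ.- c) ℚ.* d) ⟩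
      a ℚ.* (b ℚ.- d) ℚ.+ (a ℚ.* d ℚ.+ (ℚ.- c) ℚ.* d)
        ≡⟨ cong (a ℚ.* (b ℚ.- d) ℚ.+_) (sym (ℚ.*-distribʳ-+ d a (ℚ.- c))) ⟩
      a ℚ.* (b ℚ.- d) ℚ.+ (a ℚ.- c) ℚ.* d ∎
      where open ≡-Reasoning

    +-cauchy : ∀ x y → IsCauchy x → IsCauchy y → IsCauchy (λ n → x n ℚ.+ y n)
    +-cauchy x y cx cy ε 0<ε with cx (½ ℚ.* ε) (half-pos 0<ε) | cy (½ ℚ.* ε) (half-pos 0<ε)
    ... | N , hx | M , hy = N ℕ.⊔ M , λ m n p q → begin-strict
      ∣ (x m ℚ.+ y m) ℚ.- (x n ℚ.+ y n) ∣
        ≡⟨ cong ∣_∣ (regroup (x m) (y m) (x n) (y n)) ⟩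
      ∣ (x m ℚ.- x n) ℚ.+ (y m ℚ.- y n) ∣
        ≤⟨ ℚ.∣p+q∣≤∣p∣+∣q∣ (x m ℚ.- x n) (y m ℚ.- y n) ⟩
      ∣ x m ℚ.- x n ∣ ℚ.+ ∣ y m ℚ.- y n ∣
        <⟨ ℚ.+-mono-< (hx m n (ℕ.m⊔n≤o⇒m≤o N M p) (ℕ.m⊔n≤o⇒m≤o N M q))
                      (hy m n (ℕ.m⊔n≤o⇒n≤o N M p) (ℕ.m⊔n≤o⇒n≤o N M q)) ⟩
      ½ ℚ.* ε ℚ.+ ½ ℚ.* ε
        ≡⟨ halves ε ⟩
      ε ∎
      where
      open ℚ.≤-Reasoning
      regroup : ∀ a b c d → (a ℚ.+ b) ℚ.- (c ℚ.+ d) ≡ (a ℚ.- c) ℚ.+ (b ℚ.- d)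
      regroup a b c d = trans (cong (a ℚ.+ b ℚ.+_) (ℚ.neg-distrib-+ c d))
                              (interchange a b (ℚ.- c) (ℚ.- d))

    neg-cauchy : ∀ x → IsCauchy x → IsCauchy (λ n → ℚ.- x n)
    neg-cauchy x cx ε 0<ε with cx ε 0<ε
    ... | N , hx = N , λ m n p q →
      subst (ℚ._< ε)
            (trans (sym (ℚ.∣-p∣≡∣p∣ (x m ℚ.- x n)))
                   (cong ∣_∣ (ℚ.neg-distrib-+ (x m) (ℚ.- x n))))
            (hx m n p q)

    eventually-bounded : ∀ x → IsCauchy x →
      ∃ λ B → 0ℚ ℚ.< B × ∃ λ N → ∀ n → N ℕ.≤ n → ∣ x n ∣ ℚ.≤ B
    eventually-bounded x cx with cx 1ℚ (ℚ.positive⁻¹ 1ℚ)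
    ... | N , hx = 1ℚ ℚ.+ ∣ x N ∣
                 , ℚ.+-mono-<-≤ (ℚ.positive⁻¹ 1ℚ) (ℚ.0≤∣p∣ (x N))
                 , N
                 , λ n p → begin
      ∣ x n ∣                       ≡⟨ cong ∣_∣ (sym (p-q+q≡p (x n) (x N))) ⟩
      ∣ (x n ℚ.- x N) ℚ.+ x N ∣     ≤⟨ ℚ.∣p+q∣≤∣p∣+∣q∣ (x n ℚ.- x N) (x N) ⟩
      ∣ x n ℚ.- x N ∣ ℚ.+ ∣ x N ∣   ≤⟨ ℚ.+-monoˡ-≤ ∣ x N ∣ (ℚ.<⇒≤ (hx n N p ℕ.≤-refl)) ⟩
      1ℚ ℚ.+ ∣ x N ∣                ∎
      where
      open ℚ.≤-Reasoning

    product-bound : ∀ {A B δ} a b c d → 0ℚ ℚ.< A → 0ℚ ℚ.≤ δ → ∣ a ∣ ℚ.≤ A → ∣ d ∣ ℚ.≤ B →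
      ∣ a ℚ.- c ∣ ℚ.< δ → ∣ b ℚ.- d ∣ ℚ.< δ →
      ∣ a ℚ.* b ℚ.- c ℚ.* d ∣ ℚ.< A ℚ.* δ ℚ.+ δ ℚ.* B
    product-bound {A} {B} {δ} a b c d 0<A 0≤δ a≤A d≤B a-c<δ b-d<δ = begin-strict
      ∣ a ℚ.* b ℚ.- c ℚ.* d ∣
        ≡⟨ cong ∣_∣ (product-difference a b c d) ⟩
      ∣ a ℚ.* (b ℚ.- d) ℚ.+ (a ℚ.- c) ℚ.* d ∣
        ≤⟨ ℚ.∣p+q∣≤∣p∣+∣q∣ (a ℚ.* (b ℚ.- d)) ((a ℚ.- c) ℚ.* d) ⟩
      ∣ a ℚ.* (b ℚ.- d) ∣ ℚ.+ ∣ (a ℚ.- c) ℚ.* d ∣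
        ≡⟨ cong₂ ℚ._+_ (ℚ.∣p*q∣≡∣p∣*∣q∣ a (b ℚ.- d)) (ℚ.∣p*q∣≡∣p∣*∣q∣ (a ℚ.- c) d) ⟩
      ∣ a ∣ ℚ.* ∣ b ℚ.- d ∣ ℚ.+ ∣ a ℚ.- c ∣ ℚ.* ∣ d ∣
        ≤⟨ ℚ.+-mono-≤
             (ℚ.*-monoʳ-≤-nonNeg ∣ b ℚ.- d ∣ {{ℚ.∣-∣-nonNeg (b ℚ.- d)}} a≤A)
             (ℚ.*-monoʳ-≤-nonNeg ∣ d ∣ {{ℚ.∣-∣-nonNeg d}} (ℚ.<⇒≤ a-c<δ)) ⟩
      A ℚ.* ∣ b ℚ.- d ∣ ℚ.+ δ ℚ.* ∣ d ∣
        <⟨ ℚ.+-mono-<-≤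
             (ℚ.*-monoʳ-<-pos A {{ℚ.positive 0<A}} b-d<δ)
             (ℚ.*-monoˡ-≤-nonNeg δ {{ℚ.nonNegative 0≤δ}} d≤B) ⟩
      A ℚ.* δ ℚ.+ δ ℚ.* B ∎
      where open ℚ.≤-Reasoning

    quotient-pos : ∀ {ε C} → 0ℚ ℚ.< ε → 0ℚ ℚ.< C → ∃ λ δ → 0ℚ ℚ.< δ × δ ℚ.* C ≡ ε
    quotient-pos {ε} {C} 0<ε 0<C =
        ε ℚ.* ℚ.1/ C
      , subst (ℚ._< ε ℚ.* ℚ.1/ C) (ℚ.*-zeroˡ (ℚ.1/ C))
          (ℚ.*-monoˡ-<-pos (ℚ.1/ C) {{ℚ.1/pos⇒pos C}} 0<ε)
      , trans (ℚ.*-assoc ε (ℚ.1/ C) C)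
          (trans (cong (ε ℚ.*_) (ℚ.*-inverseˡ C)) (ℚ.*-identityʳ ε))
      where
      instance
        C-pos : ℚ.Positive C
        C-pos = ℚ.positive 0<C
        C-nonZero : ℚ.NonZero C
        C-nonZero = ℚ.pos⇒nonZero C

    *-cauchy : ∀ x y → IsCauchy x → IsCauchy y → IsCauchy (λ n → x n ℚ.* y n)
    *-cauchy x y cx cy ε 0<ε =
      let A , 0<A , N₁ , bx = eventually-bounded x cx
          B , 0<B , N₂ , by = eventually-bounded y cy
          δ , 0<δ , δC≡ε = quotient-pos 0<ε (ℚ.+-mono-< 0<A 0<B)
          N₃ , hx = cx δ 0<δ
          N₄ , hy = cy δ 0<δ
          total = trans (cong (ℚ._+ δ ℚ.* B) (ℚ.*-comm A δ))
                        (trans (sym (ℚ.*-distribˡ-+ δ A B)) δC≡ε)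
      in (N₁ ℕ.⊔ N₂) ℕ.⊔ (N₃ ℕ.⊔ N₄) , λ m n p q →
        let p₁₂ = ℕ.m⊔n≤o⇒m≤o (N₁ ℕ.⊔ N₂) (N₃ ℕ.⊔ N₄) p
            p₃₄ = ℕ.m⊔n≤o⇒n≤o (N₁ ℕ.⊔ N₂) (N₃ ℕ.⊔ N₄) p
            q₁₂ = ℕ.m⊔n≤o⇒m≤o (N₁ ℕ.⊔ N₂) (N₃ ℕ.⊔ N₄) q
            q₃₄ = ℕ.m⊔n≤o⇒n≤o (N₁ ℕ.⊔ N₂) (N₃ ℕ.⊔ N₄) q
        in subst (∣ x m ℚ.* y m ℚ.- x n ℚ.* y n ∣ ℚ.<_) total
             (product-bound (x m) (y m) (x n) (y n) 0<A (ℚ.<⇒≤ 0<δ)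
               (bx m (ℕ.m⊔n≤o⇒m≤o N₁ N₂ p₁₂))
               (by n (ℕ.m⊔n≤o⇒n≤o N₁ N₂ q₁₂))
               (hx m n (ℕ.m⊔n≤o⇒m≤o N₃ N₄ p₃₄) (ℕ.m⊔n≤o⇒m≤o N₃ N₄ q₃₄))
               (hy m n (ℕ.m⊔n≤o⇒n≤o N₃ N₄ p₃₄) (ℕ.m⊔n≤o⇒n≤o N₃ N₄ q₃₄)))

infix  8 -_
infixl 7 _*_
infixl 6 _+_ _-_

_+_ : ℝ → ℝ → ℝ
x + y = mkℝ (λ n → seq x n ℚ.+ seq y n) (+-cauchy (seq x) (seq y) (cauchy x) (cauchy y))

-_ : ℝ → ℝ
- x = mkℝ (λ n → ℚ.- seq x n) (neg-cauchy (seq x) (cauchy x))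

_-_ : ℝ → ℝ → ℝ
x - y = x + (- y)

_*_ : ℝ → ℝ → ℝ
x * y = mkℝ (λ n → seq x n ℚ.* seq y n) (*-cauchy (seq x) (seq y) (cauchy x) (cauchy y))

ℝ-rawRing : RawRing 0ℓ 0ℓ
ℝ-rawRing = record
  { Carrier = ℝ ; _≈_ = _≃_ ; _+_ = _+_ ; _*_ = _*_ ; -_ = -_ ; 0# = 0ℝ ; 1# = 1ℝ }

open import Algebra.Definitions.RawMonoid (RawRing.+-rawMonoid ℝ-rawRing) public using (sum)

IsLeastUpperBound : (ℝ → Set) → ℝ → Set
IsLeastUpperBound P s =
  (∀ x → P x → x ≤ s) × (∀ u → (∀ x → P x → x ≤ u) → s ≤ u)

record SimpleGraph (n : ℕ) : Set₁ where
  field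
    Edge   : Rel (Fin n) 0ℓ
    -- Automatic classically; constructively it is part of being a finite graph.
    edge?  : Decidable Edge
    symm   : Symmetric Edge
    irrefl : Irreflexive _≡_ Edge

open SimpleGraph public using (Edge)

Isomorphic : ∀ {n} → SimpleGraph n → SimpleGraph n → Set
Isomorphic {n} G₁ G₂ =
  ∃ λ (σ : Permutation′ n) → ∀ x y → Edge G₂ (σ ⟨$⟩ʳ x) (σ ⟨$⟩ʳ y) ⇔ Edge G₁ x y

SquareMatrix : Set → Set
SquareMatrix I = I → I → ℝ

IsSymmetric : ∀ {I} → SquareMatrix I → Set
IsSymmetric M = ∀ a b → M a b ≃ M b a

CompletelyPositive : ∀ {I} → SquareMatrix I → Set
CompletelyPositive {I} M =
  IsSymmetric M ×
  ∃ λ (k : ℕ) → ∃ λ (Q : I → Fin k → ℝ) →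
    (∀ a l → 0ℝ ≤ Q a l) ×
    (∀ a b → M a b ≃ sum (λ l → Q a l * Q b l))

-- The index set {ij ∣ i,j ∈ [n]} ∪ {ω}, of size n² + 1.
data Index (n : ℕ) : Set where
  _·_ : Fin n → Fin n → Index n
  ω   : Index n

record Feasible {n : ℕ} (G₁ G₂ : SimpleGraph n) (Y : SquareMatrix (Index n)) : Set where
  field
    symmetric          : IsSymmetric Y
    completelyPositive : CompletelyPositive Y
    corner             : Y ω ω ≃ 1ℝ
    border             : ∀ i j → Y (i · j) ω ≃ Y (i · j) (i · j)
    row-zero           : ∀ i j k → j ≢ k → Y (i · j) (i · k) ≃ 0ℝ
    column-zero        : ∀ i j k → j ≢ k → Y (j · i) (k · i) ≃ 0ℝ
    edge-nonedge-zero  : ∀ i j k l → Edge G₁ i k → ¬ Edge G₂ j l → Y (i · j) (k · l) ≃ 0ℝ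
    nonedge-edge-zero  : ∀ i j k l → ¬ Edge G₁ i k → Edge G₂ j l → Y (i · j) (k · l) ≃ 0ℝ

objective : ∀ {n} → SquareMatrix (Index n) → ℝ
objective Y = sum (λ i → sum (λ j → Y (i · j) (i · j)))

AttainedValue : ∀ {n} → SimpleGraph n → SimpleGraph n → ℝ → Set
AttainedValue G₁ G₂ v = ∃ λ Y → Feasible G₁ G₂ Y × objective Y ≃ v

-- Since _≃_ is not propositional equality, the optimal value is a relation;
-- it determines its real argument up to _≃_.
IsOptimalValue : ∀ {n} → SimpleGraph n → SimpleGraph n → ℝ → Set
IsOptimalValue G₁ G₂ = IsLeastUpperBound (AttainedValue G₁ G₂)

1/4n⁴ : (n : ℕ) → .{{NonZero n}} → ℚ
1/4n⁴ n = (+ 1 ℚ./ (4 ℕ.* n ℕ.^ 4)) {{ℕ.m*n≢0 4 (n ℕ.^ 4) {{_}} {{ℕ.m^n≢0 n 4}}}}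

{-# OPTIONS --safe #-}
-- The optimal value is the size α of a largest partial isomorphism, that is, of
-- a largest independent set of the conflict relation on Fin n × Fin n; it is
-- attained by a 0/1 matrix of rank one. For the upper bound, the
-- Motzkin–Straus argument shows, for weights q ≥ 0 and every t,
--   2 t Σ_v q_v ≤ α t² + Σ_{v ~ w} q_v q_w.
-- Summing over the columns of Q in Y = Q Qᵀ, with t the entry at ω, gives
-- 2 Σ_v Y_{vω} ≤ α Y_{ωω} + Σ_{v ~ w} Y_{vw}, which for feasible Y reads
-- 2 s ≤ α + s with s the objective value. Finally α ≤ n, with equality iff the
-- graphs are isomorphic, so otherwise the optimal value is at most n − 1.
module Submission where

open import Defs
open import Data.Nat using (ℕ; NonZero)
open import Data.Product using (∃; _×_)
open import Function.Bundles using (_⇔_)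
open import Relation.Nullary using (¬_)

open import Data.Fin as Fin using (Fin)
open import Data.Fin.Permutation using (Permutation; permutation; _⟨$⟩ʳ_; _⟨$⟩ˡ_; flip; _∘ₚ_; inverseʳ; inverseˡ)
import Data.Fin.Properties as Fin
open import Data.Integer as ℤ using (+_)
import Data.Integer.Properties as ℤ
open import Data.List using (List; []; _∷_; _++_; length; map; filter; tabulate; allFin; cartesianProduct; take; lookup)
import Data.List.Extrema as Extrema
open import Data.List.Membership.DecPropositional using () renaming (_∈?_ to member?)
open import Data.List.Membership.Propositional using (_∈_; find; lose)
open import Data.List.Membership.Propositional.Properties using (∈-filter⁺; ∈-filter⁻; ∈-lookup; ∈-cartesianProduct⁺; ∈-allFin)
open import Data.List.Properties using (length-take; length-tabulate)
open import Data.List.Relation.Unary.All as All using (All; []; _∷_)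
import Data.List.Relation.Unary.All.Properties as All
open import Data.List.Relation.Unary.AllPairs as AllPairs using (AllPairs; []; _∷_)
import Data.List.Relation.Unary.AllPairs.Properties as AllPairs
open import Data.List.Relation.Unary.Any as Any using (here; there)
import Data.List.Relation.Unary.Any.Properties as Any
open import Data.List.Relation.Unary.Unique.Propositional using (Unique)
import Data.List.Relation.Unary.Unique.Propositional.Properties as Unique
open import Data.Nat as ℕ using (zero; suc)
import Data.Nat.Properties as ℕ
open import Data.Product using (_,_; proj₁; proj₂)
open import Data.Product.Properties using (≡-dec)
open import Data.Rational as ℚ using (ℚ; 0ℚ; 1ℚ; ½; ∣_∣)
import Data.Rational.Properties as ℚ
open import Data.Rational.Solver using (module +-*-Solver)
import Data.Rational.Unnormalised as ℚᵘ
import Data.Rational.Unnormalised.Properties as ℚᵘ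
open import Data.Sum using (_⊎_; inj₁; inj₂; [_,_]′)
open import Function using (_∘_; id)
open import Function.Bundles using (Equivalence; mk⇔)
open import Function.Definitions using (Injective)
open import Level using (0ℓ)
open import Relation.Binary using (DecTotalOrder; Rel; Reflexive; Symmetric; Decidable; DecidableEquality)
open import Relation.Binary.PropositionalEquality hiding ([_])
open import Relation.Nullary using (Dec; yes; no; ¬?; contradiction)
open import Relation.Nullary.Decidable using (map′; _⊎-dec_; _×-dec_; decidable-stable)

open +-*-Solver using (solve; con; :-_; _:+_; _:*_; _:-_; _:=_)
open Extrema (DecTotalOrder.totalOrder ℚ.≤-decTotalOrder) using (argmin; argmin-sel; f[argmin]≤f[xs]; f[argmin]≤f[⊤])

-- Finite sums of rationals over lists, and guarded terms.

∑ : {A : Set} → List A → (A → ℚ) → ℚ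
∑ []       f = 0ℚ
∑ (x ∷ xs) f = f x ℚ.+ ∑ xs f

when : {P : Set} → Dec P → ℚ → ℚ
when (yes _) x = x
when (no _)  x = 0ℚ

when-*ʳ : {P : Set} (d : Dec P) (x y : ℚ) → when d x ℚ.* y ≡ when d (x ℚ.* y)
when-*ʳ (yes _) x y = refl
when-*ʳ (no _)  x y = ℚ.*-zeroˡ y

when-*ˡ : {P : Set} (d : Dec P) (x y : ℚ) → x ℚ.* when d y ≡ when d (x ℚ.* y)
when-*ˡ (yes _) x y = refl
when-*ˡ (no _)  x y = ℚ.*-zeroʳ x

when-mono : {P : Set} (d : Dec P) {x y : ℚ} → x ℚ.≤ y → when d x ℚ.≤ when d y
when-mono (yes _) x≤y = x≤y
when-mono (no _)  _   = ℚ.≤-refl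

when-nonNeg : {P : Set} (d : Dec P) {x : ℚ} → 0ℚ ℚ.≤ x → 0ℚ ℚ.≤ when d x
when-nonNeg (yes _) 0≤x = 0≤x
when-nonNeg (no _)  _   = ℚ.≤-refl

when-true : {P : Set} (d : Dec P) → P → ∀ x → when d x ≡ x
when-true (yes _) _ x = refl
when-true (no ¬p) p x = contradiction p ¬p

when-false : {P : Set} (d : Dec P) → ¬ P → ∀ x → when d x ≡ 0ℚ
when-false (yes p) ¬p x = contradiction p ¬p
when-false (no _)  _  x = refl

0≤p*q : ∀ {p q} → 0ℚ ℚ.≤ p → 0ℚ ℚ.≤ q → 0ℚ ℚ.≤ p ℚ.* q
0≤p*q {p} {q} 0≤p 0≤q = ℚ.nonNegative⁻¹ (p ℚ.* q)
  {{ℚ.nonNeg*nonNeg⇒nonNeg p {{ℚ.nonNegative 0≤p}} q {{ℚ.nonNegative 0≤q}}}}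

0≤p*p : ∀ p → 0ℚ ℚ.≤ p ℚ.* p
0≤p*p p with ℚ.≤-total 0ℚ p
... | inj₁ 0≤p = 0≤p*q 0≤p 0≤p
... | inj₂ p≤0 = subst (0ℚ ℚ.≤_) (solve 1 (λ p → (:- p) :* (:- p) := p :* p) refl p)
    (0≤p*q (ℚ.neg-antimono-≤ p≤0) (ℚ.neg-antimono-≤ p≤0))

-- This is the nonnegativity of `(t - m)²`, rearranged.
2tm≤t²+m² : ∀ t m → t ℚ.* m ℚ.+ t ℚ.* m ℚ.≤ t ℚ.* t ℚ.+ m ℚ.* m
2tm≤t²+m² t m = subst₂ ℚ._≤_ (ℚ.+-identityʳ _)
  (solve 2 (λ t m → (t :* m :+ t :* m) :+ (t :- m) :* (t :- m) := t :* t :+ m :* m) refl t m)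
  (ℚ.+-monoʳ-≤ (t ℚ.* m ℚ.+ t ℚ.* m) (0≤p*p (t ℚ.- m)))

module _ {A : Set} where

  ∑-cong : ∀ (xs : List A) {f g : A → ℚ} → (∀ x → f x ≡ g x) → ∑ xs f ≡ ∑ xs g
  ∑-cong []       f≡g = refl
  ∑-cong (x ∷ xs) f≡g = cong₂ ℚ._+_ (f≡g x) (∑-cong xs f≡g)

  ∑-mono : ∀ {xs : List A} {f g : A → ℚ} → All (λ x → f x ℚ.≤ g x) xs → ∑ xs f ℚ.≤ ∑ xs g
  ∑-mono []       = ℚ.≤-refl
  ∑-mono (p ∷ ps) = ℚ.+-mono-≤ p (∑-mono ps)

  ∑-zero : ∀ (xs : List A) → ∑ xs (λ _ → 0ℚ) ≡ 0ℚ
  ∑-zero []       = refl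
  ∑-zero (x ∷ xs) = trans (ℚ.+-identityˡ _) (∑-zero xs)

  ∑-nonNeg : ∀ (xs : List A) {f : A → ℚ} → (∀ x → 0ℚ ℚ.≤ f x) → 0ℚ ℚ.≤ ∑ xs f
  ∑-nonNeg xs 0≤f = ℚ.≤-trans (ℚ.≤-reflexive (sym (∑-zero xs))) (∑-mono (All.universal 0≤f xs))

  ∑-+ : ∀ (xs : List A) (f g : A → ℚ) → ∑ xs (λ x → f x ℚ.+ g x) ≡ ∑ xs f ℚ.+ ∑ xs g
  ∑-+ []       f g = refl
  ∑-+ (x ∷ xs) f g = trans (cong (f x ℚ.+ g x ℚ.+_) (∑-+ xs f g))
    (solve 4 (λ a b c d → (a :+ b) :+ (c :+ d) := (a :+ c) :+ (b :+ d)) refl (f x) (g x) (∑ xs f) (∑ xs g))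

  ∑-*ˡ : ∀ c (xs : List A) (f : A → ℚ) → c ℚ.* ∑ xs f ≡ ∑ xs (λ x → c ℚ.* f x)
  ∑-*ˡ c []       f = ℚ.*-zeroʳ c
  ∑-*ˡ c (x ∷ xs) f = trans (ℚ.*-distribˡ-+ c (f x) (∑ xs f)) (cong (c ℚ.* f x ℚ.+_) (∑-*ˡ c xs f))

  ∑-*ʳ : ∀ (xs : List A) (f : A → ℚ) c → ∑ xs f ℚ.* c ≡ ∑ xs (λ x → f x ℚ.* c)
  ∑-*ʳ xs f c = trans (ℚ.*-comm (∑ xs f) c)
    (trans (∑-*ˡ c xs f) (∑-cong xs (λ x → ℚ.*-comm c (f x))))

  ∑-++ : ∀ (xs ys : List A) f → ∑ (xs ++ ys) f ≡ ∑ xs f ℚ.+ ∑ ys f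
  ∑-++ []       ys f = sym (ℚ.+-identityˡ _)
  ∑-++ (x ∷ xs) ys f = trans (cong (f x ℚ.+_) (∑-++ xs ys f)) (sym (ℚ.+-assoc (f x) _ _))

  -- The part satisfying `P` stays a guarded sum over all of `xs`, which is the shape of a weighted
  -- degree. The remainder is a sum over a sublist, on which an induction can continue.
  ∑-filter : ∀ {P : A → Set} (P? : ∀ x → Dec (P x)) (xs : List A) f →
    ∑ xs f ≡ ∑ xs (λ x → when (P? x) (f x)) ℚ.+ ∑ (filter (¬? ∘ P?) xs) f
  ∑-filter P? []       f = refl
  ∑-filter P? (x ∷ xs) f with P? x
  ... | yes _ = trans (cong (f x ℚ.+_) (∑-filter P? xs f)) (sym (ℚ.+-assoc (f x) _ _))
  ... | no _  = trans (cong (f x ℚ.+_) (∑-filter P? xs f))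
    (solve 3 (λ a b c → a :+ (b :+ c) := (con 0ℚ :+ b) :+ (a :+ c)) refl (f x) (∑ xs (λ x → when (P? x) (f x))) (∑ (filter (¬? ∘ P?) xs) f))

when-∑ : {P A : Set} (d : Dec P) (xs : List A) (f : A → ℚ) → ∑ xs (λ x → when d (f x)) ≡ when d (∑ xs f)
when-∑ (yes _) xs f = refl
when-∑ (no _)  xs f = ∑-zero xs

∑-map : {A B : Set} (h : A → B) (xs : List A) (f : B → ℚ) → ∑ (map h xs) f ≡ ∑ xs (f ∘ h)
∑-map h []       f = refl
∑-map h (x ∷ xs) f = cong (f (h x) ℚ.+_) (∑-map h xs f)

∑-product : {A B : Set} (xs : List A) (ys : List B) (f : A × B → ℚ) →
  ∑ (cartesianProduct xs ys) f ≡ ∑ xs (λ x → ∑ ys (λ y → f (x , y)))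
∑-product []       ys f = refl
∑-product (x ∷ xs) ys f = trans (∑-++ (map (x ,_) ys) _ f)
  (cong₂ ℚ._+_ (∑-map (x ,_) ys f) (∑-product xs ys f))

∑-swap : {A B : Set} (xs : List A) (ys : List B) (f : A → B → ℚ) →
  ∑ xs (λ x → ∑ ys (f x)) ≡ ∑ ys (λ y → ∑ xs (λ x → f x y))
∑-swap []       ys f = sym (∑-zero ys)
∑-swap (x ∷ xs) ys f = trans (cong (∑ ys (f x) ℚ.+_) (∑-swap xs ys f))
  (sym (∑-+ ys (f x) (λ y → ∑ xs (λ x → f x y))))

module _ {A : Set} (_≟_ : DecidableEquality A) where

  ∑-δ-∉ : ∀ {v : A} {xs} → All (v ≢_) xs → ∀ c → ∑ xs (λ w → when (v ≟ w) c) ≡ 0ℚ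
  ∑-δ-∉ []           c = refl
  ∑-δ-∉ {v} {x ∷ xs} (v≢x ∷ v∉xs) c =
    trans (cong₂ ℚ._+_ (when-false (v ≟ x) v≢x c) (∑-δ-∉ v∉xs c)) refl

  -- Uniqueness of `xs` makes the Kronecker delta fire exactly once; a repeated entry would count
  -- `c` with multiplicity.
  ∑-δ : ∀ {v : A} {xs} → Unique xs → v ∈ xs → ∀ c → ∑ xs (λ w → when (v ≟ w) c) ≡ c
  ∑-δ {v} {x ∷ xs} (x∉xs ∷ u) (here refl) c =
    trans (cong₂ ℚ._+_ (when-true (v ≟ x) refl c) (∑-δ-∉ x∉xs c)) (ℚ.+-identityʳ c)
  ∑-δ {v} {x ∷ xs} (x∉xs ∷ u) (there v∈xs) c =
    trans (cong₂ ℚ._+_ (when-false (v ≟ x) (λ v≡x → All.lookup x∉xs v∈xs (sym v≡x)) c) (∑-δ u v∈xs c))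
          (ℚ.+-identityˡ c)

-- Natural numbers as rationals.

⟦_⟧ : ℕ → ℚ
⟦ k ⟧ = + k ℚ./ 1

-- Normalisation by a gcd keeps `⟦ k ⟧` from computing for a variable `k`. The proof therefore
-- passes to unnormalised fractions, where all denominators are 1.
⟦suc⟧ : ∀ k → ⟦ suc k ⟧ ≡ 1ℚ ℚ.+ ⟦ k ⟧
⟦suc⟧ k = ℚ.toℚᵘ-injective (begin
  ℚ.toℚᵘ ⟦ suc k ⟧                       ≈⟨ ℚ.toℚᵘ-fromℚᵘ (ℚᵘ.mkℚᵘ (+ suc k) 0) ⟩
  ℚᵘ.mkℚᵘ (+ suc k) 0                    ≈⟨ ℚᵘ.*≡* (cong (λ i → (+ 1 ℤ.+ i) ℤ.* + 1) (sym (ℤ.*-identityʳ (+ k)))) ⟩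
  ℚᵘ.1ℚᵘ ℚᵘ.+ ℚᵘ.mkℚᵘ (+ k) 0            ≈⟨ ℚᵘ.+-congʳ ℚᵘ.1ℚᵘ (ℚᵘ.≃-sym (ℚ.toℚᵘ-fromℚᵘ (ℚᵘ.mkℚᵘ (+ k) 0))) ⟩
  ℚᵘ.1ℚᵘ ℚᵘ.+ ℚ.toℚᵘ ⟦ k ⟧               ≈⟨ ℚ.toℚᵘ-homo-+ 1ℚ ⟦ k ⟧ ⟨
  ℚ.toℚᵘ (1ℚ ℚ.+ ⟦ k ⟧)                  ∎)
  where open ℚᵘ.≃-Reasoning

0≤⟦_⟧ : ∀ k → 0ℚ ℚ.≤ ⟦ k ⟧
0≤⟦ zero ⟧  = ℚ.≤-refl
0≤⟦ suc k ⟧ = subst (0ℚ ℚ.≤_) (sym (⟦suc⟧ k)) (ℚ.+-mono-≤ (ℚ.<⇒≤ (ℚ.positive⁻¹ 1ℚ)) 0≤⟦ k ⟧)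

∑-1 : {A : Set} (xs : List A) → ∑ xs (λ _ → 1ℚ) ≡ ⟦ length xs ⟧
∑-1 []       = refl
∑-1 (x ∷ xs) = trans (cong (1ℚ ℚ.+_) (∑-1 xs)) (sym (⟦suc⟧ (length xs)))

-- Independent sets: decidability and the independence number.

module Independence {A : Set} {_~_ : Rel A 0ℓ} (_~?_ : Decidable _~_) where

  IndependentSet : List A → Set
  IndependentSet = AllPairs (λ v w → ¬ (v ~ w))

  -- When `_~_` is reflexive, independence forces the entries of `I` to be distinct, so its length
  -- is a cardinality.
  HasIndependent : ℕ → List A → Set
  HasIndependent k xs = ∃ λ I → length I ≡ k × All (_∈ xs) I × IndependentSet I

  nonNeighbours : A → List A → List A
  nonNeighbours v = filter (¬? ∘ (v ~?_))

  extend : ∀ {k v xs} → v ∈ xs → HasIndependent k (nonNeighbours v xs) → HasIndependent (suc k) xs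
  extend {v = v} {xs} v∈xs (I , len , I⊆ , ind) =
    v ∷ I , cong suc len
          , v∈xs ∷ All.map (proj₁ ∘ ∈-filter⁻ (¬? ∘ (v ~?_)) {xs = xs}) I⊆
          , All.map (proj₂ ∘ ∈-filter⁻ (¬? ∘ (v ~?_)) {xs = xs}) I⊆ ∷ ind

  restrict : ∀ {k xs} → HasIndependent (suc k) xs → ∃ λ v → v ∈ xs × HasIndependent k (nonNeighbours v xs)
  restrict (v ∷ I , len , v∈xs ∷ I⊆ , v≁I ∷ ind) =
    v , v∈xs , I , ℕ.suc-injective len
      , All.zipWith (λ (w∈xs , v≁w) → ∈-filter⁺ (¬? ∘ (v ~?_)) w∈xs v≁w) (I⊆ , v≁I) , ind

  -- By `extend` and `restrict`, an independent set of size `suc k` amounts to a head `v` in `xs`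
  -- and one of size `k` among the non-neighbours of `v`. Recursion on `k` thus reduces the question
  -- to trying every head.
  hasIndependent? : ∀ k xs → Dec (HasIndependent k xs)
  hasIndependent? zero    xs = yes ([] , refl , [] , [])
  hasIndependent? (suc k) xs =
    map′ (λ a → let v , v∈xs , h = find a in extend v∈xs h)
         (λ h → let v , v∈xs , h′ = restrict h in lose v∈xs h′)
         (Any.any? (λ v → hasIndependent? k (nonNeighbours v xs)) xs)

  HasIndependent-antitone : ∀ {j k xs} → j ℕ.≤ k → HasIndependent k xs → HasIndependent j xs
  HasIndependent-antitone {j} j≤k (I , refl , I⊆ , ind) =
    take j I , trans (length-take j I) (ℕ.m≤n⇒m⊓n≡m j≤k) , All.take⁺ j I⊆ , AllPairs.take⁺ j ind

  -- A downward search from `m`, which must stop because the empty set has size 0.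
  independenceNumber : ∀ m xs → ¬ HasIndependent (suc m) xs →
    ∃ λ α → HasIndependent α xs × ¬ HasIndependent (suc α) xs
  independenceNumber m xs ¬h with hasIndependent? m xs
  ... | yes h = m , h , ¬h
  independenceNumber zero    xs ¬h | no ¬h′ = contradiction ([] , refl , [] , []) ¬h′
  independenceNumber (suc m) xs ¬h | no ¬h′ = independenceNumber m xs ¬h′

  -- The Motzkin-Straus inequality for nonnegative weights.

  module Weighted (~-refl : Reflexive _~_) (q : A → ℚ) (0≤q : ∀ v → 0ℚ ℚ.≤ q v) where

    degree : List A → A → ℚ
    degree xs u = ∑ xs (λ w → when (u ~? w) (q w))

    -- The quadratic form of the weights over ordered pairs `u ~ w`, diagonal included because `_~_`
    -- is reflexive.
    energy : List A → ℚ
    energy xs = ∑ xs (λ u → q u ℚ.* degree xs u)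

    degree-nonNeighbours : ∀ v xs u → degree (nonNeighbours v xs) u ℚ.≤ degree xs u
    degree-nonNeighbours v xs u = begin
      degree (nonNeighbours v xs) u         ≡⟨ ℚ.+-identityˡ _ ⟨
      0ℚ ℚ.+ degree (nonNeighbours v xs) u
        ≤⟨ ℚ.+-monoˡ-≤ _ (∑-nonNeg xs (λ w → when-nonNeg (v ~? w) (when-nonNeg (u ~? w) (0≤q w)))) ⟩
      ∑ xs (λ w → when (v ~? w) (when (u ~? w) (q w))) ℚ.+ degree (nonNeighbours v xs) u
        ≡⟨ ∑-filter (v ~?_) xs (λ w → when (u ~? w) (q w)) ⟨
      degree xs u ∎
      where open ℚ.≤-Reasoning

    -- If v has minimal degree, each neighbour u contributes at least q u * degree v.
    energy-split : ∀ {xs v} → All (λ u → degree xs v ℚ.≤ degree xs u) xs →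
      degree xs v ℚ.* degree xs v ℚ.+ energy (nonNeighbours v xs) ℚ.≤ energy xs
    energy-split {xs} {v} v-min = begin
      degree xs v ℚ.* degree xs v ℚ.+ energy (nonNeighbours v xs)
        ≤⟨ ℚ.+-mono-≤ neighbours (∑-mono (All.universal (λ u →
             ℚ.*-monoˡ-≤-nonNeg (q u) {{ℚ.nonNegative (0≤q u)}} (degree-nonNeighbours v xs u)) (nonNeighbours v xs))) ⟩
      ∑ xs (λ u → when (v ~? u) (q u ℚ.* degree xs u)) ℚ.+ ∑ (nonNeighbours v xs) (λ u → q u ℚ.* degree xs u)
        ≡⟨ ∑-filter (v ~?_) xs (λ u → q u ℚ.* degree xs u) ⟨
      energy xs ∎
      where
      open ℚ.≤-Reasoning
      neighbours : degree xs v ℚ.* degree xs v ℚ.≤ ∑ xs (λ u → when (v ~? u) (q u ℚ.* degree xs u))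
      neighbours = begin
        degree xs v ℚ.* degree xs v
          ≡⟨ ∑-*ʳ xs (λ u → when (v ~? u) (q u)) (degree xs v) ⟩
        ∑ xs (λ u → when (v ~? u) (q u) ℚ.* degree xs v)
          ≡⟨ ∑-cong xs (λ u → when-*ʳ (v ~? u) (q u) (degree xs v)) ⟩
        ∑ xs (λ u → when (v ~? u) (q u ℚ.* degree xs v))
          ≤⟨ ∑-mono (All.map (λ {u} d≤ → when-mono (v ~? u)
               (ℚ.*-monoˡ-≤-nonNeg (q u) {{ℚ.nonNegative (0≤q u)}} d≤)) v-min) ⟩
        ∑ xs (λ u → when (v ~? u) (q u ℚ.* degree xs u)) ∎

    -- Greedy induction on `α`: remove a vertex `v` of minimal weighted degree `m` together with its
    -- neighbours. The weight removed is exactly `m`, and `2tm ≤ t² + m²` pays for it: `t²` raises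
    -- the coefficient by one, while `energy-split` supplies `m²`. By `extend`, what remains has
    -- smaller independent sets.
    motzkin-straus : ∀ α xs → ¬ HasIndependent (suc α) xs → ∀ t →
      t ℚ.* ∑ xs q ℚ.+ t ℚ.* ∑ xs q ℚ.≤ ⟦ α ⟧ ℚ.* (t ℚ.* t) ℚ.+ energy xs
    motzkin-straus α [] _ t = ℚ.≤-trans
      (ℚ.≤-reflexive (trans (cong₂ ℚ._+_ (ℚ.*-zeroʳ t) (ℚ.*-zeroʳ t)) refl))
      (ℚ.≤-trans (0≤p*q 0≤⟦ α ⟧ (0≤p*p t)) (ℚ.≤-reflexive (sym (ℚ.+-identityʳ _))))
    -- A singleton is always independent, so `α = 0` leaves only the empty list.
    motzkin-straus zero (x ∷ xs) ¬h t =
      contradiction (x ∷ [] , refl , here refl ∷ [] , [] ∷ []) ¬h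
    motzkin-straus (suc α) xs@(x ∷ xs′) ¬h t = begin
      t ℚ.* ∑ xs q ℚ.+ t ℚ.* ∑ xs q
        ≡⟨ cong (λ s → t ℚ.* s ℚ.+ t ℚ.* s) (∑-filter (v ~?_) xs q) ⟩
      t ℚ.* (m ℚ.+ s) ℚ.+ t ℚ.* (m ℚ.+ s)
        ≡⟨ solve 3 (λ t m s → t :* (m :+ s) :+ t :* (m :+ s) := (t :* m :+ t :* m) :+ (t :* s :+ t :* s)) refl t m s ⟩
      (t ℚ.* m ℚ.+ t ℚ.* m) ℚ.+ (t ℚ.* s ℚ.+ t ℚ.* s)
        ≤⟨ ℚ.+-mono-≤ (2tm≤t²+m² t m) (motzkin-straus α (nonNeighbours v xs) (¬h ∘ extend v∈xs) t) ⟩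
      (t ℚ.* t ℚ.+ m ℚ.* m) ℚ.+ (⟦ α ⟧ ℚ.* (t ℚ.* t) ℚ.+ energy (nonNeighbours v xs))
        ≡⟨ solve 4 (λ a t m e → (t :* t :+ m :* m) :+ (a :* (t :* t) :+ e)
             := (con 1ℚ :+ a) :* (t :* t) :+ (m :* m :+ e)) refl ⟦ α ⟧ t m (energy (nonNeighbours v xs)) ⟩
      (1ℚ ℚ.+ ⟦ α ⟧) ℚ.* (t ℚ.* t) ℚ.+ (m ℚ.* m ℚ.+ energy (nonNeighbours v xs))
        ≤⟨ ℚ.+-monoʳ-≤ ((1ℚ ℚ.+ ⟦ α ⟧) ℚ.* (t ℚ.* t)) (energy-split v-min) ⟩
      (1ℚ ℚ.+ ⟦ α ⟧) ℚ.* (t ℚ.* t) ℚ.+ energy xs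
        ≡⟨ cong (λ a → a ℚ.* (t ℚ.* t) ℚ.+ energy xs) (⟦suc⟧ α) ⟨
      ⟦ suc α ⟧ ℚ.* (t ℚ.* t) ℚ.+ energy xs ∎
      where
      open ℚ.≤-Reasoning
      v = argmin (degree xs) x xs′
      m = degree xs v
      s = ∑ (nonNeighbours v xs) q
      v∈xs : v ∈ xs
      v∈xs = [ here , there ]′ (argmin-sel (degree xs) x xs′)
      v-min : All (λ u → m ℚ.≤ degree xs u) xs
      v-min = f[argmin]≤f[⊤] {f = degree xs} x xs′ ∷ f[argmin]≤f[xs] {f = degree xs} x xs′

-- Null sequences and asymptotic equality of rational sequences.

Eventually : (ℕ → Set) → Set
Eventually P = ∃ λ N → ∀ n → N ℕ.≤ n → P n

both : ∀ {P Q : ℕ → Set} → Eventually P → Eventually Q → Eventually (λ n → P n × Q n)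
both (M , p) (N , q) = M ℕ.⊔ N , λ n M⊔N≤n →
  p n (ℕ.m⊔n≤o⇒m≤o M N M⊔N≤n) , q n (ℕ.m⊔n≤o⇒n≤o M N M⊔N≤n)

eventually-map : ∀ {P Q : ℕ → Set} → (∀ {n} → P n → Q n) → Eventually P → Eventually Q
eventually-map f (N , p) = N , λ n N≤n → f (p n N≤n)

infix 4 _≈_
infixl 6 _⊞_
infixl 7 _⊠_

_⊞_ _⊠_ : (ℕ → ℚ) → (ℕ → ℚ) → (ℕ → ℚ)
(f ⊞ g) n = f n ℚ.+ g n
(f ⊠ g) n = f n ℚ.* g n

Null Bounded : (ℕ → ℚ) → Set
Null f = ∀ ε → 0ℚ ℚ.< ε → Eventually (λ n → ∣ f n ∣ ℚ.< ε)
Bounded f = ∃ λ B → 0ℚ ℚ.< B × Eventually (λ n → ∣ f n ∣ ℚ.≤ B)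

-- A record, unlike _≃_, so that f and g can be inferred.
record _≈_ (f g : ℕ → ℚ) : Set where
  constructor ⟨_⟩
  field null-difference : Null (λ n → f n ℚ.- g n)

open _≈_

0<½ε : ∀ {ε} → 0ℚ ℚ.< ε → 0ℚ ℚ.< ½ ℚ.* ε
0<½ε {ε} 0<ε = subst (ℚ._< ½ ℚ.* ε) (ℚ.*-zeroʳ ½) (ℚ.*-monoʳ-<-pos ½ 0<ε)

½ε+½ε≡ε : ∀ ε → ½ ℚ.* ε ℚ.+ ½ ℚ.* ε ≡ ε
½ε+½ε≡ε = solve 1 (λ ε → con ½ :* ε :+ con ½ :* ε := ε) refl

p≤∣p∣ : ∀ p → p ℚ.≤ ∣ p ∣
p≤∣p∣ p with ℚ.≤-total 0ℚ p
... | inj₁ 0≤p = ℚ.≤-reflexive (sym (ℚ.0≤p⇒∣p∣≡p 0≤p))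
... | inj₂ p≤0 = ℚ.≤-trans p≤0 (ℚ.0≤∣p∣ p)

null-resp : ∀ {f g} → (∀ n → f n ≡ g n) → Null f → Null g
null-resp f≡g null ε 0<ε =
  eventually-map (λ {n} → subst (λ p → ∣ p ∣ ℚ.< ε) (f≡g n)) (null ε 0<ε)

null-0 : Null (λ _ → 0ℚ)
null-0 ε 0<ε = 0 , λ _ _ → 0<ε

null-neg : ∀ {f} → Null f → Null (λ n → ℚ.- f n)
null-neg {f} null ε 0<ε =
  eventually-map (λ {n} → subst (ℚ._< ε) (sym (ℚ.∣-p∣≡∣p∣ (f n)))) (null ε 0<ε)

null-+ : ∀ {f g} → Null f → Null g → Null (f ⊞ g)
null-+ {f} {g} nf ng ε 0<ε =
  eventually-map (λ {n} (f< , g<) → ℚ.≤-<-trans (ℚ.∣p+q∣≤∣p∣+∣q∣ (f n) (g n))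
    (ℚ.<-≤-trans (ℚ.+-mono-< f< g<) (ℚ.≤-reflexive (½ε+½ε≡ε ε))))
    (both (nf (½ ℚ.* ε) (0<½ε 0<ε)) (ng (½ ℚ.* ε) (0<½ε 0<ε)))

null-* : ∀ {f g} → Bounded f → Null g → Null (f ⊠ g)
null-* {f} {g} (B , 0<B , f≤B) ng ε 0<ε =
  eventually-map (λ {n} (f≤ , g<) → begin-strict
      ∣ f n ℚ.* g n ∣       ≡⟨ ℚ.∣p*q∣≡∣p∣*∣q∣ (f n) (g n) ⟩
      ∣ f n ∣ ℚ.* ∣ g n ∣   ≤⟨ ℚ.*-monoʳ-≤-nonNeg ∣ g n ∣ {{ℚ.∣-∣-nonNeg (g n)}} f≤ ⟩
      B ℚ.* ∣ g n ∣         <⟨ ℚ.*-monoʳ-<-pos B g< ⟩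
      B ℚ.* (ε ℚ.* ℚ.1/ B)  ≡⟨ cong (B ℚ.*_) (ℚ.*-comm ε (ℚ.1/ B)) ⟩
      B ℚ.* (ℚ.1/ B ℚ.* ε)  ≡⟨ ℚ.*-assoc B (ℚ.1/ B) ε ⟨
      B ℚ.* ℚ.1/ B ℚ.* ε    ≡⟨ cong (ℚ._* ε) (ℚ.*-inverseʳ B) ⟩
      1ℚ ℚ.* ε              ≡⟨ ℚ.*-identityˡ ε ⟩
      ε                     ∎)
    -- The tolerance `ε / B` for `g` compensates for the bound `B` on `f`.
    (both f≤B (ng (ε ℚ.* ℚ.1/ B)
      (subst (ℚ._< ε ℚ.* ℚ.1/ B) (ℚ.*-zeroˡ (ℚ.1/ B)) (ℚ.*-monoˡ-<-pos (ℚ.1/ B) {{ℚ.1/pos⇒pos B}} 0<ε))))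
  where
  open ℚ.≤-Reasoning
  instance
    B-pos : ℚ.Positive B
    B-pos = ℚ.positive 0<B
    B-nonZero : ℚ.NonZero B
    B-nonZero = ℚ.pos⇒nonZero B

≡⇒≈ : ∀ {f g} → (∀ n → f n ≡ g n) → f ≈ g
≡⇒≈ {f} {g} f≡g = ⟨ null-resp (λ n → sym (trans (cong (ℚ._- g n) (f≡g n)) (ℚ.+-inverseʳ (g n)))) null-0 ⟩

≈-sym : ∀ {f g} → f ≈ g → g ≈ f
≈-sym {f} {g} f≈g = ⟨ null-resp (λ n → solve 2 (λ p q → :- (p :- q) := q :- p) refl (f n) (g n)) (null-neg (null-difference f≈g)) ⟩

≈-trans : ∀ {f g h} → f ≈ g → g ≈ h → f ≈ h
≈-trans {f} {g} {h} f≈g g≈h = ⟨ null-resp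
  (λ n → solve 3 (λ p q r → (p :- q) :+ (q :- r) := p :- r) refl (f n) (g n) (h n))
  (null-+ (null-difference f≈g) (null-difference g≈h)) ⟩

⊞-cong : ∀ {f f′ g g′} → f ≈ f′ → g ≈ g′ → f ⊞ g ≈ f′ ⊞ g′
⊞-cong {f} {f′} {g} {g′} f≈f′ g≈g′ = ⟨ null-resp
  (λ n → solve 4 (λ p p′ q q′ → (p :- p′) :+ (q :- q′) := (p :+ q) :- (p′ :+ q′)) refl (f n) (f′ n) (g n) (g′ n))
  (null-+ (null-difference f≈f′) (null-difference g≈g′)) ⟩

-- The difference of the products is `f (g - g′) + g′ (f - f′)`, which is why boundedness is asked
-- of `f` and `g′`.
⊠-cong : ∀ {f f′ g g′} → Bounded f → Bounded g′ → f ≈ f′ → g ≈ g′ → f ⊠ g ≈ f′ ⊠ g′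
⊠-cong {f} {f′} {g} {g′} bf bg′ f≈f′ g≈g′ = ⟨ null-resp
  (λ n → solve 4 (λ p p′ q q′ → p :* (q :- q′) :+ q′ :* (p :- p′) := p :* q :- p′ :* q′) refl (f n) (f′ n) (g n) (g′ n))
  (null-+ (null-* bf (null-difference g≈g′)) (null-* bg′ (null-difference f≈f′))) ⟩

∑-≈ : ∀ {A : Set} {xs : List A} {f g : A → ℕ → ℚ} → All (λ x → f x ≈ g x) xs →
  (λ n → ∑ xs (λ x → f x n)) ≈ (λ n → ∑ xs (λ x → g x n))
∑-≈ []       = ⟨ null-0 ⟩
∑-≈ (p ∷ ps) = ⟨ null-difference (⊞-cong p (∑-≈ ps)) ⟩

-- Each of the two replacements costs half of `ε`. The conclusion has the form of `_≤_` on reals, so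
-- termwise inequalities can be carried to the limit.
squeeze : ∀ {f f′ g g′} → f ≈ f′ → g ≈ g′ → (∀ n → f n ℚ.≤ g n) →
  ∀ ε → 0ℚ ℚ.< ε → Eventually (λ n → f′ n ℚ.≤ g′ n ℚ.+ ε)
squeeze {f} {f′} {g} {g′} f≈f′ g≈g′ f≤g ε 0<ε =
  eventually-map (λ {n} (f< , g<) → begin
      f′ n                              ≡⟨ solve 2 (λ p q → p := q :+ (p :- q)) refl (f′ n) (f n) ⟩
      f n ℚ.+ (f′ n ℚ.- f n)            ≤⟨ ℚ.+-mono-≤ (f≤g n) (≤-½ε {p = f′ n ℚ.- f n} f<) ⟩
      g n ℚ.+ ½ ℚ.* ε                   ≡⟨ solve 3 (λ p q e → p :+ con ½ :* e := q :+ (p :- q) :+ con ½ :* e) refl (g n) (g′ n) ε ⟩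
      g′ n ℚ.+ (g n ℚ.- g′ n) ℚ.+ ½ ℚ.* ε  ≤⟨ ℚ.+-monoˡ-≤ (½ ℚ.* ε) (ℚ.+-monoʳ-≤ (g′ n) (≤-½ε {p = g n ℚ.- g′ n} g<)) ⟩
      g′ n ℚ.+ ½ ℚ.* ε ℚ.+ ½ ℚ.* ε      ≡⟨ solve 2 (λ q e → q :+ con ½ :* e :+ con ½ :* e := q :+ e) refl (g′ n) ε ⟩
      g′ n ℚ.+ ε                        ∎)
    (both (null-difference (≈-sym f≈f′) (½ ℚ.* ε) (0<½ε 0<ε)) (null-difference g≈g′ (½ ℚ.* ε) (0<½ε 0<ε)))
  where
  open ℚ.≤-Reasoning
  ≤-½ε : ∀ {p} → ∣ p ∣ ℚ.< ½ ℚ.* ε → p ℚ.≤ ½ ℚ.* ε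
  ≤-½ε {p} p< = ℚ.≤-trans (p≤∣p∣ p) (ℚ.<⇒≤ p<)

seq-bounded : ∀ x → Bounded (seq x)
seq-bounded x with cauchy x 1ℚ (ℚ.positive⁻¹ 1ℚ)
... | N , close = 1ℚ ℚ.+ ∣ seq x N ∣ , ℚ.+-mono-<-≤ (ℚ.positive⁻¹ 1ℚ) (ℚ.0≤∣p∣ (seq x N)) , N , λ n N≤n → begin
    ∣ seq x n ∣                            ≡⟨ cong ∣_∣ (solve 2 (λ p q → p := (p :- q) :+ q) refl (seq x n) (seq x N)) ⟩
    ∣ seq x n ℚ.- seq x N ℚ.+ seq x N ∣    ≤⟨ ℚ.∣p+q∣≤∣p∣+∣q∣ (seq x n ℚ.- seq x N) (seq x N) ⟩
    ∣ seq x n ℚ.- seq x N ∣ ℚ.+ ∣ seq x N ∣ ≤⟨ ℚ.+-monoˡ-≤ ∣ seq x N ∣ (ℚ.<⇒≤ (close n N N≤n ℕ.≤-refl)) ⟩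
    1ℚ ℚ.+ ∣ seq x N ∣                     ∎
  where open ℚ.≤-Reasoning

-- Truncation at zero, and termwise sums and order of reals.

_⁺ : ℚ → ℚ
p ⁺ = p ℚ.⊔ 0ℚ

∣p⁺∣≤∣p∣ : ∀ p → ∣ p ⁺ ∣ ℚ.≤ ∣ p ∣
∣p⁺∣≤∣p∣ p with ℚ.≤-total p 0ℚ
... | inj₁ p≤0 = subst (λ r → ∣ r ∣ ℚ.≤ ∣ p ∣) (sym (ℚ.p≤q⇒p⊔q≡q p≤0)) (ℚ.0≤∣p∣ p)
... | inj₂ 0≤p = ℚ.≤-reflexive (cong ∣_∣ (ℚ.p≥q⇒p⊔q≡p 0≤p))

-- Truncation only changes a negative `p`, and then by `- p`, which the second hypothesis bounds by
-- `ε`.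
∣p-p⁺∣≤ε : ∀ p {ε} → 0ℚ ℚ.≤ ε → 0ℚ ℚ.≤ p ℚ.+ ε → ∣ p ℚ.- p ⁺ ∣ ℚ.≤ ε
∣p-p⁺∣≤ε p {ε} 0≤ε 0≤p+ε with ℚ.≤-total p 0ℚ
... | inj₂ 0≤p = subst (ℚ._≤ ε) (sym (cong ∣_∣ (trans (cong (λ r → p ℚ.- r) (ℚ.p≥q⇒p⊔q≡p 0≤p)) (ℚ.+-inverseʳ p)))) 0≤ε
... | inj₁ p≤0 = begin
  ∣ p ℚ.- p ⁺ ∣  ≡⟨ cong (λ r → ∣ p ℚ.- r ∣) (ℚ.p≤q⇒p⊔q≡q p≤0) ⟩
  ∣ p ℚ.- 0ℚ ∣   ≡⟨ cong ∣_∣ (ℚ.+-identityʳ p) ⟩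
  ∣ p ∣          ≡⟨ ℚ.∣-p∣≡∣p∣ p ⟨
  ∣ ℚ.- p ∣      ≡⟨ ℚ.0≤p⇒∣p∣≡p (ℚ.neg-antimono-≤ p≤0) ⟩
  ℚ.- p          ≡⟨ ℚ.+-identityʳ (ℚ.- p) ⟨
  ℚ.- p ℚ.+ 0ℚ   ≤⟨ ℚ.+-monoʳ-≤ (ℚ.- p) 0≤p+ε ⟩
  ℚ.- p ℚ.+ (p ℚ.+ ε)  ≡⟨ solve 2 (λ p e → :- p :+ (p :+ e) := e) refl p ε ⟩
  ε              ∎
  where open ℚ.≤-Reasoning

-- 0ℝ ≤ x does not make the terms of x nonnegative, but motzkin-straus is
-- applied termwise.
seq⁺ : ℝ → ℕ → ℚ
seq⁺ x n = seq x n ⁺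

seq⁺-bounded : ∀ x → Bounded (seq⁺ x)
seq⁺-bounded x = let B , 0<B , x≤B = seq-bounded x in
  B , 0<B , eventually-map (λ {n} → ℚ.≤-trans (∣p⁺∣≤∣p∣ (seq x n))) x≤B

-- The assumption `0ℝ ≤ x` keeps the terms eventually above any negative rational, so truncation
-- moves them arbitrarily little. Asking for half of `ε` makes the bound strict.
seq≈seq⁺ : ∀ x → 0ℝ ≤ x → seq x ≈ seq⁺ x
seq≈seq⁺ x 0≤x = ⟨ (λ ε 0<ε → eventually-map
  (λ {n} h → ℚ.≤-<-trans (∣p-p⁺∣≤ε (seq x n) (ℚ.<⇒≤ (0<½ε 0<ε)) h)
    (subst₂ ℚ._<_ (ℚ.+-identityˡ _) (½ε+½ε≡ε ε) (ℚ.+-monoˡ-< (½ ℚ.* ε) (0<½ε 0<ε))))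
  (0≤x (½ ℚ.* ε) (0<½ε 0<ε))) ⟩

-- The labelling `g` is arbitrary so that the recursion can shift it by `Fin.suc`; with `g = id` the
-- list is `allFin k`.
seq-sum : ∀ {k} {A : Set} (f : Fin k → ℝ) (g : Fin k → A) (h : A → ℚ) n →
  (∀ i → seq (f i) n ≡ h (g i)) → seq (sum f) n ≡ ∑ (tabulate g) h
seq-sum {zero}  f g h n eq = refl
seq-sum {suc k} f g h n eq = cong₂ ℚ._+_ (eq Fin.zero) (seq-sum (f ∘ Fin.suc) (g ∘ Fin.suc) h n (eq ∘ Fin.suc))

≤-antisym : ∀ {x y} → x ≤ y → y ≤ x → x ≃ y
≤-antisym {x} {y} x≤y y≤x ε 0<ε = eventually-map
  (λ {n} (p , q) → ℚ.≤-<-trans (bound n p q)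
    (subst₂ ℚ._<_ (ℚ.+-identityˡ _) (½ε+½ε≡ε ε) (ℚ.+-monoˡ-< (½ ℚ.* ε) (0<½ε 0<ε))))
  (both (x≤y (½ ℚ.* ε) (0<½ε 0<ε)) (y≤x (½ ℚ.* ε) (0<½ε 0<ε)))
  where
  p≤q+ε⇒p-q≤ε : ∀ p q {ε} → p ℚ.≤ q ℚ.+ ε → p ℚ.- q ℚ.≤ ε
  p≤q+ε⇒p-q≤ε p q {ε} p≤q+ε = subst (p ℚ.- q ℚ.≤_)
    (solve 2 (λ q e → q :+ e :- q := e) refl q ε) (ℚ.+-monoˡ-≤ (ℚ.- q) p≤q+ε)
  bound : ∀ n → seq x n ℚ.≤ seq y n ℚ.+ ½ ℚ.* ε → seq y n ℚ.≤ seq x n ℚ.+ ½ ℚ.* ε →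
    ∣ seq x n ℚ.- seq y n ∣ ℚ.≤ ½ ℚ.* ε
  bound n p q with ℚ.∣p∣≡p∨∣p∣≡-p (seq x n ℚ.- seq y n)
  ... | inj₁ eq = subst (ℚ._≤ ½ ℚ.* ε) (sym eq) (p≤q+ε⇒p-q≤ε (seq x n) (seq y n) p)
  ... | inj₂ eq = subst (ℚ._≤ ½ ℚ.* ε)
    (sym (trans eq (solve 2 (λ p q → :- (p :- q) := q :- p) refl (seq x n) (seq y n))))
    (p≤q+ε⇒p-q≤ε (seq y n) (seq x n) q)

-- Distinct positions in lists and injections between finite sets.

AllPairs-lookup : ∀ {A : Set} {R : Rel A 0ℓ} → Symmetric R → ∀ {xs} → AllPairs R xs →
  ∀ {i j} → i ≢ j → R (lookup xs i) (lookup xs j)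
AllPairs-lookup sym-R (px ∷ pxs) {Fin.zero}  {Fin.zero}  i≢j = contradiction refl i≢j
AllPairs-lookup sym-R {x ∷ xs} (px ∷ pxs) {Fin.zero}  {Fin.suc j} i≢j = All.lookup px (∈-lookup {xs = xs} j)
AllPairs-lookup sym-R {x ∷ xs} (px ∷ pxs) {Fin.suc i} {Fin.zero}  i≢j = sym-R (All.lookup px (∈-lookup {xs = xs} i))
AllPairs-lookup sym-R (px ∷ pxs) {Fin.suc i} {Fin.suc j} i≢j = AllPairs-lookup sym-R pxs (i≢j ∘ cong Fin.suc)

-- Pigeonhole: punching a missed value out of the codomain would leave an injection from
-- `Fin (suc n)` into `Fin n`.
injective⇒surjective : ∀ {n} {f : Fin n → Fin n} → Injective _≡_ _≡_ f → ∀ y → ∃ λ x → f x ≡ y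
injective⇒surjective {suc n} {f} inj y with Fin.any? (λ x → f x Fin.≟ y)
... | yes hit = hit
... | no miss = contradiction
  (Fin.injective⇒≤ {f = λ x → Fin.punchOut (λ y≡fx → miss (x , sym y≡fx))}
    (λ {a} {b} eq → inj (Fin.punchOut-injective (λ e → miss (a , sym e)) (λ e → miss (b , sym e)) eq)))
  ℕ.1+n≰n

-- Two sizes related by an equation, because the maps of interest start at positions
-- `Fin (length I)`.
injective⇒permutation : ∀ {m n} {f : Fin m → Fin n} → m ≡ n → Injective _≡_ _≡_ f →
  ∃ λ (π : Permutation m n) → ∀ x → π ⟨$⟩ʳ x ≡ f x
injective⇒permutation {f = f} refl inj =
  permutation f (proj₁ ∘ onto) (proj₂ ∘ onto) (λ x → inj (proj₂ (onto (f x)))) , λ _ → refl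
  where onto = injective⇒surjective inj

-- The conflict graph: independent sets of size `n` are isomorphisms.

module Conflict {n : ℕ} (G₁ G₂ : SimpleGraph n) where

  open SimpleGraph using (edge?; symm; irrefl)

  Vertex : Set
  Vertex = Fin n × Fin n

  _≟_ : DecidableEquality Vertex
  _≟_ = ≡-dec Fin._≟_ Fin._≟_

  -- Reflexive; an independent set is the graph of a partial isomorphism.
  infix 4 _~_
  _~_ : Rel Vertex 0ℓ
  (i , j) ~ (k , l) = i ≡ k ⊎ j ≡ l ⊎ (Edge G₁ i k × ¬ Edge G₂ j l) ⊎ (¬ Edge G₁ i k × Edge G₂ j l)

  _~?_ : Decidable _~_
  (i , j) ~? (k , l) = (i Fin.≟ k) ⊎-dec (j Fin.≟ l)
    ⊎-dec (edge? G₁ i k ×-dec ¬? (edge? G₂ j l)) ⊎-dec (¬? (edge? G₁ i k) ×-dec edge? G₂ j l)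

  ~-refl : Reflexive _~_
  ~-refl = inj₁ refl

  ~-sym : Symmetric _~_
  ~-sym (inj₁ i≡k)                       = inj₁ (sym i≡k)
  ~-sym (inj₂ (inj₁ j≡l))                = inj₂ (inj₁ (sym j≡l))
  ~-sym (inj₂ (inj₂ (inj₁ (e , ¬e′))))   = inj₂ (inj₂ (inj₁ (symm G₁ e , ¬e′ ∘ symm G₂)))
  ~-sym (inj₂ (inj₂ (inj₂ (¬e , e′))))   = inj₂ (inj₂ (inj₂ (¬e ∘ symm G₁ , symm G₂ e′)))

  open Independence _~?_

  vertices : List Vertex
  vertices = cartesianProduct (allFin n) (allFin n)

  ∈-vertices : ∀ v → v ∈ vertices
  ∈-vertices (i , j) = ∈-cartesianProduct⁺ (∈-allFin i) (∈-allFin j)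

  vertices-unique : Unique vertices
  vertices-unique = Unique.cartesianProduct⁺ (Unique.allFin⁺ n) (Unique.allFin⁺ n)

  module _ {I : List Vertex} (ind : IndependentSet I) where

    separated : ∀ {p q} → p ≢ q → ¬ lookup I p ~ lookup I q
    separated = AllPairs-lookup (λ ¬r → ¬r ∘ ~-sym) ind

    proj₁-injective : Injective _≡_ _≡_ (proj₁ ∘ lookup I)
    proj₁-injective {p} {q} eq with p Fin.≟ q
    ... | yes p≡q = p≡q
    ... | no p≢q  = contradiction (inj₁ eq) (separated p≢q)

    proj₂-injective : Injective _≡_ _≡_ (proj₂ ∘ lookup I)
    proj₂-injective {p} {q} eq with p Fin.≟ q
    ... | yes p≡q = p≡q
    ... | no p≢q  = contradiction (inj₂ (inj₁ eq)) (separated p≢q)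

    -- At equal positions irreflexivity excludes both edges. At distinct positions a disagreement
    -- would be a conflict, and decidability of edges turns its refutation into the required edge.
    edges-agree : ∀ p q → Edge G₂ (proj₂ (lookup I p)) (proj₂ (lookup I q)) ⇔ Edge G₁ (proj₁ (lookup I p)) (proj₁ (lookup I q))
    edges-agree p q with p Fin.≟ q
    ... | yes refl = mk⇔ (λ e → contradiction e (irrefl G₂ refl)) (λ e → contradiction e (irrefl G₁ refl))
    ... | no p≢q   = mk⇔
      (λ e₂ → decidable-stable (edge? G₁ _ _) (λ ¬e₁ → separated p≢q (inj₂ (inj₂ (inj₂ (¬e₁ , e₂))))))
      (λ e₁ → decidable-stable (edge? G₂ _ _) (λ ¬e₂ → separated p≢q (inj₂ (inj₂ (inj₁ (e₁ , ¬e₂))))))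

    unique : Unique I
    unique = AllPairs.map (λ { ¬r refl → ¬r ~-refl }) ind

  -- First coordinates of an independent set are pairwise distinct elements of `Fin n`.
  ¬hasIndependent-1+n : ¬ HasIndependent (suc n) vertices
  ¬hasIndependent-1+n (I , len , _ , ind) =
    ℕ.1+n≰n (subst (ℕ._≤ n) len (Fin.injective⇒≤ (proj₁-injective ind)))

  isomorphic⇒hasIndependent : Isomorphic G₁ G₂ → HasIndependent n vertices
  isomorphic⇒hasIndependent (σ , pres) =
    tabulate graph , length-tabulate graph , All.tabulate⁺ (∈-vertices ∘ graph) , AllPairs.tabulate⁺ ¬conflict
    where
    graph : Fin n → Vertex
    graph x = x , σ ⟨$⟩ʳ x
    ¬conflict : ∀ {x y} → x ≢ y → ¬ graph x ~ graph y
    ¬conflict x≢y (inj₁ x≡y)        = x≢y x≡y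
    ¬conflict x≢y (inj₂ (inj₁ σx≡σy)) = x≢y (trans (sym (inverseˡ σ)) (trans (cong (σ ⟨$⟩ˡ_) σx≡σy) (inverseˡ σ)))
    ¬conflict {x} {y} x≢y (inj₂ (inj₂ (inj₁ (e₁ , ¬e₂)))) = ¬e₂ (Equivalence.from (pres x y) e₁)
    ¬conflict {x} {y} x≢y (inj₂ (inj₂ (inj₂ (¬e₁ , e₂)))) = ¬e₁ (Equivalence.to (pres x y) e₂)

  -- Positions in `I` serve as a common index set: if the bijections `a` and `b` read off first and
  -- second coordinates, the isomorphism is `a` inverted, followed by `b`.
  hasIndependent⇒isomorphic : HasIndependent n vertices → Isomorphic G₁ G₂
  hasIndependent⇒isomorphic (I , len , _ , ind) =
    let a , a≡ = injective⇒permutation len (proj₁-injective ind)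
        b , b≡ = injective⇒permutation len (proj₂-injective ind)
        first x = trans (sym (a≡ (a ⟨$⟩ˡ x))) (inverseʳ a)
        second x = sym (b≡ (a ⟨$⟩ˡ x))
    in flip a ∘ₚ b , λ x y →
      subst₂ _⇔_ (cong₂ (Edge G₂) (second x) (second y)) (cong₂ (Edge G₁) (first x) (first y))
        (edges-agree ind (a ⟨$⟩ˡ x) (a ⟨$⟩ˡ y))

  index : Vertex → Index n
  index (i , j) = i · j

  seq-objective : ∀ (Y : SquareMatrix (Index n)) m →
    seq (objective Y) m ≡ ∑ vertices (λ v → seq (Y (index v) (index v)) m)
  seq-objective Y m = trans
    (seq-sum (λ i → sum (λ j → Y (i · j) (i · j))) id _ m
      (λ i → seq-sum (λ j → Y (i · j) (i · j)) id (λ j → seq (Y (i · j) (i · j)) m) m (λ _ → refl)))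
    (sym (∑-product (allFin n) (allFin n) (λ v → seq (Y (index v) (index v)) m)))

  nonadjacent : ∀ {I} → IndependentSet I → ∀ {v w} → v ∈ I → w ∈ I → v ≢ w → ¬ v ~ w
  nonadjacent {I} ind {v} {w} v∈I w∈I v≢w =
    subst₂ (λ v w → ¬ v ~ w) (sym (Any.lookup-index v∈I)) (sym (Any.lookup-index w∈I))
      (separated ind (λ eq → v≢w (trans (Any.lookup-index v∈I)
        (trans (cong (lookup I) eq) (sym (Any.lookup-index w∈I))))))

  -- Lower bound: the rank-one feasible matrix of an independent set.

  module _ {I : List Vertex} (ind : IndependentSet I) where

    _∈I? : ∀ v → Dec (v ∈ I)
    v ∈I? = member? _≟_ v I

    -- The entry 1 at `ω` makes the corner 1 and reproduces `χ` on the border; the diagonal agrees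
    -- because 0 and 1 are their own squares.
    χ : Index n → ℚ
    χ (i · j) = when ((i , j) ∈I?) 1ℚ
    χ ω       = 1ℚ

    χχᵀ : SquareMatrix (Index n)
    χχᵀ a b = fromℚ (χ a ℚ.* χ b)

    χ-nonNeg : ∀ a → 0ℚ ℚ.≤ χ a
    χ-nonNeg (i · j) = when-nonNeg ((i , j) ∈I?) (ℚ.<⇒≤ (ℚ.positive⁻¹ 1ℚ))
    χ-nonNeg ω       = ℚ.<⇒≤ (ℚ.positive⁻¹ 1ℚ)

    χ-idem : ∀ v → χ (index v) ℚ.* χ (index v) ≡ χ (index v)
    χ-idem v with v ∈I?
    ... | yes _ = refl
    ... | no _  = refl

    χ-conflict : ∀ v w → v ~ w → v ≢ w → χ (index v) ℚ.* χ (index w) ≡ 0ℚ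
    χ-conflict v w v~w v≢w with v ∈I? | w ∈I?
    ... | yes v∈I | yes w∈I = contradiction v~w (nonadjacent ind v∈I w∈I v≢w)
    ... | yes _   | no _    = refl
    ... | no _    | yes _   = refl
    ... | no _    | no _    = refl

    χ-count : ∀ v → χ (index v) ≡ ∑ I (λ w → when (v ≟ w) 1ℚ)
    χ-count v with v ∈I?
    ... | yes v∈I = sym (∑-δ _≟_ (unique ind) v∈I 1ℚ)
    ... | no v∉I  = sym (∑-δ-∉ _≟_ (All.¬Any⇒All¬ I v∉I) 1ℚ)

    -- Double counting: after the sums are exchanged, each member of `I` is met exactly once among
    -- `vertices`.
    χ-sum : ∑ vertices (χ ∘ index) ≡ ⟦ length I ⟧
    χ-sum = begin
      ∑ vertices (χ ∘ index)                               ≡⟨ ∑-cong vertices χ-count ⟩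
      ∑ vertices (λ v → ∑ I (λ w → when (v ≟ w) 1ℚ))       ≡⟨ ∑-swap vertices I _ ⟩
      ∑ I (λ w → ∑ vertices (λ v → when (v ≟ w) 1ℚ))       ≡⟨ ∑-cong I (λ w → ∑-cong vertices (λ v → when-sym (v ≟ w) (w ≟ v))) ⟩
      ∑ I (λ w → ∑ vertices (λ v → when (w ≟ v) 1ℚ))       ≡⟨ ∑-cong I (λ w → ∑-δ _≟_ vertices-unique (∈-vertices w) 1ℚ) ⟩
      ∑ I (λ _ → 1ℚ)                                       ≡⟨ ∑-1 I ⟩
      ⟦ length I ⟧                                         ∎
      where
      open ≡-Reasoning
      when-sym : ∀ {v w : Vertex} (d : Dec (v ≡ w)) (e : Dec (w ≡ v)) → when d 1ℚ ≡ when e 1ℚ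
      when-sym (yes refl) e = sym (when-true e refl 1ℚ)
      when-sym (no v≢w)   e = sym (when-false e (v≢w ∘ sym) 1ℚ)

    χχᵀ-symmetric : IsSymmetric χχᵀ
    χχᵀ-symmetric a b = null-difference (≡⇒≈ (λ _ → ℚ.*-comm (χ a) (χ b)))

    χχᵀ-conflict : ∀ v w → v ~ w → v ≢ w → χχᵀ (index v) (index w) ≃ 0ℝ
    χχᵀ-conflict v w v~w v≢w = null-difference (≡⇒≈ (λ _ → χ-conflict v w v~w v≢w))

    χχᵀ-feasible : Feasible G₁ G₂ χχᵀ
    χχᵀ-feasible = record
      { symmetric          = χχᵀ-symmetric
      ; completelyPositive = χχᵀ-symmetric , 1 , (λ a _ → fromℚ (χ a))
          , (λ a _ ε 0<ε → 0 , λ _ _ → ℚ.+-mono-≤ (χ-nonNeg a) (ℚ.<⇒≤ 0<ε))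
          , (λ a b → null-difference (≡⇒≈ (λ _ → sym (ℚ.+-identityʳ (χ a ℚ.* χ b)))))
      ; corner             = null-difference (≡⇒≈ {seq (χχᵀ ω ω)} {seq 1ℝ} (λ _ → refl))
      ; border             = λ i j → null-difference (≡⇒≈ (λ _ →
          trans (ℚ.*-identityʳ (χ (i · j))) (sym (χ-idem (i , j)))))
      ; row-zero           = λ i j k j≢k →
          χχᵀ-conflict (i , j) (i , k) (inj₁ refl) (j≢k ∘ cong proj₂)
      ; column-zero        = λ i j k j≢k →
          χχᵀ-conflict (j , i) (k , i) (inj₂ (inj₁ refl)) (j≢k ∘ cong proj₁)
      -- Endpoints of an edge differ, so these constraints never touch the diagonal.
      ; edge-nonedge-zero  = λ i j k l e₁ ¬e₂ →
          χχᵀ-conflict (i , j) (k , l) (inj₂ (inj₂ (inj₁ (e₁ , ¬e₂)))) (λ eq → irrefl G₁ (cong proj₁ eq) e₁)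
      ; nonedge-edge-zero  = λ i j k l ¬e₁ e₂ →
          χχᵀ-conflict (i , j) (k , l) (inj₂ (inj₂ (inj₂ (¬e₁ , e₂)))) (λ eq → irrefl G₂ (cong proj₂ eq) e₂)
      }

    attained : AttainedValue G₁ G₂ (fromℕ (length I))
    attained = χχᵀ , χχᵀ-feasible , null-difference (≡⇒≈ (λ m →
      trans (seq-objective χχᵀ m) (trans (∑-cong vertices χ-idem) χ-sum)))

  -- Upper bound on the objective of a feasible matrix.

  module _ {Y : SquareMatrix (Index n)} (feasible : Feasible G₁ G₂ Y) where

    open Feasible feasible

    conflict-zero : ∀ v w → v ~ w → v ≢ w → Y (index v) (index w) ≃ 0ℝ
    conflict-zero (i , j) (_ , l) (inj₁ refl)                    v≢w = row-zero i j l (v≢w ∘ cong (i ,_))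
    conflict-zero (i , j) (k , _) (inj₂ (inj₁ refl))             v≢w = column-zero j i k (v≢w ∘ cong (_, j))
    conflict-zero (i , j) (k , l) (inj₂ (inj₂ (inj₁ (e₁ , ¬e₂)))) _   = edge-nonedge-zero i j k l e₁ ¬e₂
    conflict-zero (i , j) (k , l) (inj₂ (inj₂ (inj₂ (¬e₁ , e₂)))) _   = nonedge-edge-zero i j k l ¬e₁ e₂

    k = proj₁ (proj₂ completelyPositive)
    Q = proj₁ (proj₂ (proj₂ completelyPositive))
    0≤Q = proj₁ (proj₂ (proj₂ (proj₂ completelyPositive)))
    Y≃QQᵀ = proj₂ (proj₂ (proj₂ (proj₂ completelyPositive)))

    Q⁺ : ℕ → Index n → Fin k → ℚ
    Q⁺ m a l = seq⁺ (Q a l) m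

    -- At each `m` this is an exact Gram matrix of nonnegative rational columns, so termwise
    -- inequalities apply to it; the terms of `Y` match such a product only in the limit.
    P : Index n → Index n → ℕ → ℚ
    P a b m = ∑ (allFin k) (λ l → Q⁺ m a l ℚ.* Q⁺ m b l)

    Y≈P : ∀ a b → seq (Y a b) ≈ P a b
    Y≈P a b = ≈-trans ⟨ Y≃QQᵀ a b ⟩ (≈-trans
      (≡⇒≈ (λ m → seq-sum (λ l → Q a l * Q b l) id (λ l → seq (Q a l) m ℚ.* seq (Q b l) m) m (λ _ → refl)))
      (∑-≈ {xs = allFin k} {f = λ l → seq (Q a l) ⊠ seq (Q b l)} {g = λ l → seq⁺ (Q a l) ⊠ seq⁺ (Q b l)}
        (All.universal (λ l → ⊠-cong (seq-bounded (Q a l)) (seq⁺-bounded (Q b l))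
          (seq≈seq⁺ (Q a l) (0≤Q a l)) (seq≈seq⁺ (Q b l) (0≤Q b l))) (allFin k))))

    diagonal : ℕ → ℚ
    diagonal m = ∑ vertices (λ v → seq (Y (index v) (index v)) m)

    borderP : ℕ → ℚ
    borderP m = ∑ vertices (λ v → P (index v) ω m)

    conflictP : ℕ → ℚ
    conflictP m = ∑ vertices (λ v → ∑ vertices (λ w → when (v ~? w) (P (index v) (index w) m)))

    borderP≈diagonal : borderP ≈ diagonal
    borderP≈diagonal = ∑-≈ {xs = vertices} (All.universal (λ (i , j) →
      ≈-trans (≈-sym (Y≈P (i · j) ω)) ⟨ border i j ⟩) vertices)

    -- Feasibility makes every off-diagonal conflict entry vanish in the limit, and reflexivity of
    -- `_~_` keeps every diagonal entry, so the double sum collapses.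
    conflictP≈diagonal : conflictP ≈ diagonal
    conflictP≈diagonal = ≈-trans
      (∑-≈ {xs = vertices} (All.universal (λ v → ∑-≈ {xs = vertices}
        {f = λ w m → when (v ~? w) (P (index v) (index w) m)}
        {g = λ w m → when (v ≟ w) (seq (Y (index v) (index v)) m)}
        (All.universal (entry v) vertices)) vertices))
      (≡⇒≈ (λ m → ∑-cong vertices (λ v → ∑-δ _≟_ vertices-unique (∈-vertices v) _)))
      where
      entry : ∀ v w → (λ m → when (v ~? w) (P (index v) (index w) m)) ≈ (λ m → when (v ≟ w) (seq (Y (index v) (index v)) m))
      entry v w with v ~? w | v ≟ w
      ... | yes _   | yes refl = ≈-sym (Y≈P (index v) (index v))
      ... | yes v~w | no v≢w   = ≈-trans (≈-sym (Y≈P (index v) (index w))) ⟨ conflict-zero v w v~w v≢w ⟩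
      ... | no v≁w  | yes refl = contradiction (inj₁ refl) v≁w
      ... | no _    | no _     = ≡⇒≈ (λ _ → refl)

    module _ {α : ℕ} (¬h : ¬ HasIndependent (suc α) vertices) where

      motzkin-straus-P : ∀ m → borderP m ℚ.+ borderP m ℚ.≤ ⟦ α ⟧ ℚ.* P ω ω m ℚ.+ conflictP m
      motzkin-straus-P m = begin
        borderP m ℚ.+ borderP m
          ≡⟨ cong₂ ℚ._+_ border-by-columns border-by-columns ⟩
        ∑ (allFin k) (λ l → t l ℚ.* s l) ℚ.+ ∑ (allFin k) (λ l → t l ℚ.* s l)
          ≡⟨ ∑-+ (allFin k) (λ l → t l ℚ.* s l) (λ l → t l ℚ.* s l) ⟨
        ∑ (allFin k) (λ l → t l ℚ.* s l ℚ.+ t l ℚ.* s l)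
          ≤⟨ ∑-mono (All.universal (λ l → W.motzkin-straus l α vertices ¬h (t l)) (allFin k)) ⟩
        ∑ (allFin k) (λ l → ⟦ α ⟧ ℚ.* (t l ℚ.* t l) ℚ.+ W.energy l vertices)
          ≡⟨ ∑-+ (allFin k) (λ l → ⟦ α ⟧ ℚ.* (t l ℚ.* t l)) (λ l → W.energy l vertices) ⟩
        ∑ (allFin k) (λ l → ⟦ α ⟧ ℚ.* (t l ℚ.* t l)) ℚ.+ ∑ (allFin k) (λ l → W.energy l vertices)
          ≡⟨ cong₂ ℚ._+_ (sym (∑-*ˡ ⟦ α ⟧ (allFin k) (λ l → t l ℚ.* t l))) energy-by-entries ⟩
        ⟦ α ⟧ ℚ.* P ω ω m ℚ.+ conflictP m ∎
        where
        open ℚ.≤-Reasoning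
        q : Fin k → Vertex → ℚ
        q l v = Q⁺ m (index v) l
        t s : Fin k → ℚ
        t l = Q⁺ m ω l
        s l = ∑ vertices (q l)
        -- Each column is its own weight function; truncation guarantees nonnegativity at every `m`.
        module W l = Weighted ~-refl (q l) (λ v → ℚ.p≤q⊔p (seq (Q (index v) l) m) 0ℚ)
        border-by-columns : borderP m ≡ ∑ (allFin k) (λ l → t l ℚ.* s l)
        border-by-columns = trans (∑-swap vertices (allFin k) (λ v l → q l v ℚ.* t l))
          (∑-cong (allFin k) (λ l → trans (sym (∑-*ʳ vertices (q l) (t l))) (ℚ.*-comm (s l) (t l))))
        energy-by-entries : ∑ (allFin k) (λ l → W.energy l vertices) ≡ conflictP m
        energy-by-entries = trans (∑-swap (allFin k) vertices (λ l u → q l u ℚ.* W.degree l vertices u))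
          (∑-cong vertices (λ u → trans
            (∑-cong (allFin k) (λ l → trans (∑-*ˡ (q l u) vertices (λ w → when (u ~? w) (q l w)))
              (∑-cong vertices (λ w → when-*ˡ (u ~? w) (q l u) (q l w)))))
            (trans (∑-swap (allFin k) vertices (λ l w → when (u ~? w) (q l u ℚ.* q l w)))
              (∑-cong vertices (λ w → when-∑ (u ~? w) (allFin k) (λ l → q l u ℚ.* q l w))))))

      objective≤ : ∀ {x} → objective Y ≃ x → x ≤ fromℕ α
      objective≤ {x} obj≃x ε 0<ε = eventually-map (λ {m} h → cancel (seq x m) h)
        -- Border and conflict sums are both replaced by `x` and the corner by 1; one copy of `x` is
        -- then cancelled termwise.
        (squeeze (⊞-cong (≈-trans borderP≈diagonal diagonal≈x) (≈-trans borderP≈diagonal diagonal≈x))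
                 (⊞-cong (⊠-cong (seq-bounded (fromℕ α)) (seq-bounded 1ℝ) (≡⇒≈ (λ _ → refl))
                           (≈-trans (≈-sym (Y≈P ω ω)) ⟨ corner ⟩))
                         (≈-trans conflictP≈diagonal diagonal≈x))
                 motzkin-straus-P ε 0<ε)
        where
        diagonal≈x : diagonal ≈ seq x
        diagonal≈x = ≈-trans (≡⇒≈ (λ m → sym (seq-objective Y m))) ⟨ obj≃x ⟩
        cancel : ∀ y → y ℚ.+ y ℚ.≤ ⟦ α ⟧ ℚ.* 1ℚ ℚ.+ y ℚ.+ ε → y ℚ.≤ ⟦ α ⟧ ℚ.+ ε
        cancel y h = subst₂ ℚ._≤_
          (solve 1 (λ y → y :+ y :- y := y) refl y)
          (solve 3 (λ a y e → a :* con 1ℚ :+ y :+ e :- y := a :+ e) refl ⟦ α ⟧ y ε)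
          (ℚ.+-monoˡ-≤ (ℚ.- y) h)

-- Separation of integer values and the bound `1/4n⁴`.

⟦⟧-mono : ∀ {j k} → j ℕ.≤ k → ⟦ j ⟧ ℚ.≤ ⟦ k ⟧
⟦⟧-mono {k = k} ℕ.z≤n = 0≤⟦ k ⟧
⟦⟧-mono {suc j} {suc k} (ℕ.s≤s j≤k) =
  subst₂ ℚ._≤_ (sym (⟦suc⟧ j)) (sym (⟦suc⟧ k)) (ℚ.+-monoʳ-≤ 1ℚ (⟦⟧-mono j≤k))

¼ : ℚ
¼ = + 1 ℚ./ 4

0<¼ : 0ℚ ℚ.< ¼
0<¼ = ℚ.positive⁻¹ ¼

1/d≤¼ : ∀ d .{{_ : NonZero d}} → 4 ℕ.≤ d → + 1 ℚ./ d ℚ.≤ ¼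
1/d≤¼ (suc d) 4≤d = ℚ.toℚᵘ-cancel-≤ (begin
  ℚ.toℚᵘ (+ 1 ℚ./ suc d)  ≃⟨ ℚ.toℚᵘ-fromℚᵘ (ℚᵘ.mkℚᵘ (+ 1) d) ⟩
  ℚᵘ.mkℚᵘ (+ 1) d         ≤⟨ ℚᵘ.*≤* (ℤ.*-monoˡ-≤-nonNeg (+ 1) (ℤ.+≤+ 4≤d)) ⟩
  ℚᵘ.mkℚᵘ (+ 1) 3         ≃⟨ ℚᵘ.≃-refl ⟩
  ℚ.toℚᵘ ¼                ∎)
  where open ℚᵘ.≤-Reasoning

1/4n⁴≤¼ : ∀ n .{{_ : NonZero n}} → 1/4n⁴ n ℚ.≤ ¼
1/4n⁴≤¼ n = 1/d≤¼ (4 ℕ.* n ℕ.^ 4) {{ℕ.m*n≢0 4 (n ℕ.^ 4) {{_}} {{ℕ.m^n≢0 n 4}}}}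
  (ℕ.m≤m*n 4 (n ℕ.^ 4) {{ℕ.m^n≢0 n 4}})

-- The unit between `j` and `k` is divided in three: a quarter for the distance of `x` from `j`, a
-- half for strict separation, and a quarter left below `k`.
gap : ∀ {j k x} → j ℕ.< k → x ≃ fromℕ j → Eventually (λ m → seq x m ℚ.+ ½ ℚ.≤ ⟦ k ⟧ ℚ.- ¼)
gap {j} {k} {x} j<k x≃j = eventually-map (λ {m} close → begin
    seq x m ℚ.+ ½                             ≡⟨ solve 2 (λ y a → y :+ con ½ := (y :- a) :+ (con ½ :+ a)) refl (seq x m) ⟦ j ⟧ ⟩
    (seq x m ℚ.- ⟦ j ⟧) ℚ.+ (½ ℚ.+ ⟦ j ⟧)     ≤⟨ ℚ.+-monoˡ-≤ (½ ℚ.+ ⟦ j ⟧) (ℚ.≤-trans (p≤∣p∣ (seq x m ℚ.- ⟦ j ⟧)) (ℚ.<⇒≤ close)) ⟩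
    ¼ ℚ.+ (½ ℚ.+ ⟦ j ⟧)                       ≡⟨ solve 1 (λ a → con ¼ :+ (con ½ :+ a) := (con 1ℚ :+ a) :- con ¼) refl ⟦ j ⟧ ⟩
    (1ℚ ℚ.+ ⟦ j ⟧) ℚ.- ¼                      ≡⟨ cong (ℚ._- ¼) (⟦suc⟧ j) ⟨
    ⟦ suc j ⟧ ℚ.- ¼                           ≤⟨ ℚ.+-monoˡ-≤ (ℚ.- ¼) (⟦⟧-mono j<k) ⟩
    ⟦ k ⟧ ℚ.- ¼                               ∎)
  (x≃j ¼ 0<¼)
  where open ℚ.≤-Reasoning

-- A term within a quarter of `k` is at least `k - ¼`, while `gap` puts it half a unit below that.
≃fromℕ-injective : ∀ {j k x} → x ≃ fromℕ j → x ≃ fromℕ k → ¬ j ℕ.< k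
≃fromℕ-injective {j} {k} {x} x≃j x≃k j<k =
  let N , h = both (gap {x = x} j<k x≃j) (null-difference (≈-sym {seq x} {seq (fromℕ k)} ⟨ x≃k ⟩) ¼ 0<¼)
      apart , close = h N ℕ.≤-refl
      x+½≤x = ℚ.≤-trans apart (subst (⟦ k ⟧ ℚ.- ¼ ℚ.≤_)
        (solve 1 (λ y → con ¼ :+ (y :- con ¼) := y) refl (seq x N))
        (subst (ℚ._≤ ¼ ℚ.+ (seq x N ℚ.- ¼))
          (solve 2 (λ a y → (a :- y) :+ (y :- con ¼) := a :- con ¼) refl ⟦ k ⟧ (seq x N))
          (ℚ.+-monoˡ-≤ (seq x N ℚ.- ¼) (ℚ.≤-trans (p≤∣p∣ (⟦ k ⟧ ℚ.- seq x N)) (ℚ.<⇒≤ close)))))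
  in ℚ.<-irrefl refl (ℚ.<-≤-trans (subst (ℚ._< seq x N ℚ.+ ½) (ℚ.+-identityʳ (seq x N)) (ℚ.+-monoʳ-< (seq x N) (ℚ.positive⁻¹ ½))) x+½≤x)

-- The quarter that `gap` leaves below `n` covers `1/4n⁴`, and its half unit witnesses strictness.
≃fromℕ⇒<-1/4n⁴ : ∀ {j n x} .{{_ : NonZero n}} → j ℕ.< n → x ≃ fromℕ j → x < fromℕ n - fromℚ (1/4n⁴ n)
≃fromℕ⇒<-1/4n⁴ {n = n} {x} j<n x≃j = ½ , ℚ.positive⁻¹ ½ , eventually-map
  (λ h → ℚ.≤-trans h (ℚ.+-monoʳ-≤ ⟦ n ⟧ (ℚ.neg-antimono-≤ (1/4n⁴≤¼ n)))) (gap {x = x} j<n x≃j)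

-- Uniqueness of the optimum and the isomorphism test.

IsLeastUpperBound-unique : ∀ {P x y} → IsLeastUpperBound P x → IsLeastUpperBound P y → x ≃ y
IsLeastUpperBound-unique {x = x} {y} (x-ub , x-least) (y-ub , y-least) =
  ≤-antisym {x} {y} (x-least y y-ub) (y-least x x-ub)

theorem4 : ∀ (n : ℕ) (G₁ G₂ : SimpleGraph n) →
    (∃ λ cpϑ → IsOptimalValue G₁ G₂ cpϑ) ×
    (∀ cpϑ → IsOptimalValue G₁ G₂ cpϑ →
    (Isomorphic G₁ G₂ → cpϑ ≃ fromℕ n) ×
    (.{{_ : NonZero n}} → ¬ Isomorphic G₁ G₂ → cpϑ < fromℕ n - fromℚ (1/4n⁴ n)) ×
    (Isomorphic G₁ G₂ ⇔ cpϑ ≃ fromℕ n))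
theorem4 n G₁ G₂ with Independence.independenceNumber (Conflict._~?_ G₁ G₂) n (Conflict.vertices G₁ G₂) (Conflict.¬hasIndependent-1+n G₁ G₂)
-- Matching `refl` identifies `α` with `length I`, the value reached by `attained`.
... | α , hα@(I , refl , _ , ind) , ¬h = (fromℕ α , optimal) , λ cpϑ opt →
    let cpϑ≃α = IsLeastUpperBound-unique {x = cpϑ} {fromℕ α} opt optimal
        iso⇒≃ = λ iso → subst (λ j → cpϑ ≃ fromℕ j) (sym (isomorphic⇒≡ iso)) cpϑ≃α
    in iso⇒≃
     , (λ ¬iso → ≃fromℕ⇒<-1/4n⁴ {x = cpϑ} (ℕ.≤∧≢⇒< α≤n (¬iso ∘ ≡⇒isomorphic ∘ sym)) cpϑ≃α)
     , mk⇔ iso⇒≃ (λ cpϑ≃n → ≡⇒isomorphic (ℕ.≤-antisym (ℕ.≮⇒≥ (≃fromℕ-injective {x = cpϑ} cpϑ≃α cpϑ≃n)) α≤n))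
  where
  open Conflict G₁ G₂
  open Independence _~?_
  optimal : IsOptimalValue G₁ G₂ (fromℕ α)
  optimal = (λ x (Y , feasible , obj≃x) → objective≤ feasible ¬h {x} obj≃x)
          -- The value `α` is itself attained, so every upper bound dominates it.
          , (λ u u-ub → u-ub (fromℕ α) (attained ind))
  α≤n : α ℕ.≤ n
  -- If `α` exceeded `n`, the independent set could be cut down to `n + 1` elements.
  α≤n = ℕ.≮⇒≥ (λ n<α → ¬hasIndependent-1+n (HasIndependent-antitone n<α hα))
  isomorphic⇒≡ : Isomorphic G₁ G₂ → n ≡ α
  isomorphic⇒≡ iso = ℕ.≤-antisym
    (ℕ.≮⇒≥ (λ α<n → ¬h (HasIndependent-antitone α<n (isomorphic⇒hasIndependent iso)))) α≤n
  ≡⇒isomorphic : n ≡ α → Isomorphic G₁ G₂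
  ≡⇒isomorphic n≡α = hasIndependent⇒isomorphic (subst (λ j → HasIndependent j vertices) (sym n≡α) hα)
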